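{- For every positive integer $k$, there is a connected graph $G$ of girth at least $k$ and minimum degree at least $k$ such that $\alpha_b(G)\ge 2\left(1-\frac{1}{k}\right)\alpha(G)$.
   Context: All graphs are finite, simple and undirected. $\alpha(G)$ is the independence number of $G$. For a connected graph $G$, an independent broadcast on $G$ is a function $f:V(G)\to\{0,1,2,\dots\}$ such that (B1) $f(x)\le \mathrm{ecc}_G(x)$ for every vertex $x$, where $\mathrm{ecc}_G(x)$ is the eccentricity of $x$ in $G$, and (B2) $\mathrm{dist}_G(x,y)>\max\{f(x),f(y)\}$ for every two distinct vertices $x,y$ with $f(x),f(y)>0$. The weight of $f$ is $\sum_{x\in V(G)}f(x)$, and the broadcast independence number $\alpha_b(G)$ is the maximum weight of an independent broadcast on $G$. The girth of a graph is the length of a shortest cycle (infinite if the graph is acyclic). -}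

module Defs where

open import Data.Nat using (ℕ; zero; suc; _+_; _*_; _∸_; _≤_; _<_; _⊔_)
open import Data.Fin using (Fin; zero; suc; inject₁; fromℕ)
open import Data.Bool using (Bool; T; not)
open import Data.List using (List; []; _∷_; length; filter; allFin; map)
open import Data.Nat.ListAction using (sum)
open import Data.List.Relation.Unary.Unique.Propositional using (Unique)
open import Data.List.Relation.Unary.All using (All)
open import Data.List.Membership.Propositional using (_∈_)
open import Data.Product using (Σ; ∃; ∃-syntax; _×_; _,_)
open import Relation.Binary.PropositionalEquality using (_≡_)
open import Relation.Nullary using (¬_)
open import Function.Definitions using (Injective)

record Graph : Set where
  field
    n       : ℕ
    adj     : Fin n → Fin n → Bool
    sym     : ∀ x y → adj x y ≡ adj y x
    irrefl  : ∀ x → adj x x ≡ Data.Bool.false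

open Graph public

module _ (G : Graph) where

  Adj : Fin (n G) → Fin (n G) → Set
  Adj x y = T (adj G x y)

  data Walk : Fin (n G) → Fin (n G) → ℕ → Set where
    here : ∀ {x} → Walk x x 0
    step : ∀ {x y z ℓ} → Adj x y → Walk y z ℓ → Walk x z (suc ℓ)

  Connected : Set
  Connected = (0 < n G) × (∀ x y → ∃[ ℓ ] Walk x y ℓ)

  Dist : Fin (n G) → Fin (n G) → ℕ → Set
  Dist x y d = Walk x y d × (∀ ℓ → Walk x y ℓ → d ≤ ℓ)

  Ecc : Fin (n G) → ℕ → Set
  Ecc x e = (∃[ y ] Dist x y e) × (∀ y d → Dist x y d → d ≤ e)

  degree : Fin (n G) → ℕ
  degree x = length (filter (λ y → Data.Bool.T? (adj G x y)) (allFin (n G)))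

  MinDegreeAtLeast : ℕ → Set
  MinDegreeAtLeast k = ∀ x → k ≤ degree x

  -- a cycle of length (suc m): injective cyclic sequence of vertices
  -- c 0, c 1, ..., c m with consecutive vertices and c m, c 0 adjacent
  Cycle : ℕ → Set
  Cycle m = Σ (Fin (suc m) → Fin (n G)) λ c →
              Injective _≡_ _≡_ c
            × (∀ (i : Fin m) → Adj (c (inject₁ i)) (c (suc i)))
            × Adj (c (fromℕ m)) (c zero)

  -- girth ≥ k : every cycle (of length ≥ 3) has length ≥ k
  -- (vacuous for acyclic graphs, whose girth is infinite)
  GirthAtLeast : ℕ → Set
  GirthAtLeast k = ∀ m → 3 ≤ suc m → Cycle m → k ≤ suc m

  Independent : List (Fin (n G)) → Set
  Independent S = Unique S × (∀ x y → x ∈ S → y ∈ S → ¬ Adj x y)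

  IsIndependenceNumber : ℕ → Set
  IsIndependenceNumber a =
    (∃[ S ] (Independent S × length S ≡ a))
    × (∀ S → Independent S → length S ≤ a)

  IndependentBroadcast : (Fin (n G) → ℕ) → Set
  IndependentBroadcast f =
      (∀ x e → Ecc x e → f x ≤ e)
    × (∀ x y → ¬ x ≡ y → 0 < f x → 0 < f y →
         ∀ d → Dist x y d → (f x ⊔ f y) < d)

  weight : (Fin (n G) → ℕ) → ℕ
  weight f = sum (map f (allFin (n G)))

  IsBroadcastIndependenceNumber : ℕ → Set
  IsBroadcastIndependenceNumber b =
    (∃[ f ] (IndependentBroadcast f × weight f ≡ b))
    × (∀ f → IndependentBroadcast f → weight f ≤ b)

-- A derandomised version of Erdős's construction of graphs of large girth and small independence
-- number. Start with M disjoint stars K_{1,k} and only ever join leaves that are far apart: the girth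
-- stays large and distinct centres stay at distance at least 3, so the value 2 on the centres is an
-- independent broadcast of weight 2M. Let t be a small constant fraction of the number of vertices.
-- As long as few edges have been added, few vertices are saturated, that is, have reached the degree
-- bound Δ, and the ball of radius k around any vertex has at most (1 + Δ)^k ≤ t
-- elements, so any set of 3t leaves contains t² admissible pairs. By averaging, some admissible pair
-- hits a constant fraction of the at most 2^N vertex sets still to be hit, so O(N) edges destroy all
-- independent sets of 3t leaves, whence α ≤ M + 3t ≤ (1 + 1/k)M. Further edges between far apart
-- leaves, which cannot increase α, raise the degrees of the leaves and connect the graph.
module Submission where

open import Defs hiding (sym)
open import Data.Nat using (ℕ; zero; suc; _+_; _*_; _∸_; _^_; _≤_; _<_; _<ᵇ_; z≤n; s≤s; NonZero; >-nonZero; _≤?_; _≟_)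
open import Data.Nat.Properties hiding (_≟_)
open import Data.Nat.ListAction using (sum)
open import Data.Nat.Tactic.RingSolver using (solve-∀)
open import Data.Bool using (Bool; true; false; T; not; _∧_; _∨_; _xor_; T?)
open import Data.Bool.Properties using (T-∧; T-∨; ∧-comm; ∨-comm; ∧-zeroʳ; xor-comm; xor-same)
open import Data.Fin as Fin using (Fin; zero; suc; inject₁; fromℕ; toℕ; combine; remQuot)
import Data.Fin.Properties as Fin
open import Data.List using (List; []; _∷_; length; filter; map; allFin; _++_)
open import Data.List.Properties using (map-tabulate; length-tabulate; length-map; length-++; length-filter)
open import Data.List.Relation.Unary.Any using (here; there)
open import Data.List.Relation.Unary.All as All using ([]; _∷_)
open import Data.List.Relation.Unary.AllPairs using ([]; _∷_)
open import Data.List.Relation.Unary.Unique.Propositional using (Unique)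
import Data.List.Relation.Unary.Unique.Propositional.Properties as Unique
open import Data.List.Membership.Propositional using (_∈_)
open import Data.List.Membership.Propositional.Properties using (∈-allFin; ∈-map⁻; ∈-map⁺; ∈-++⁺ˡ; ∈-++⁺ʳ; ∈-filter⁺; ∈-filter⁻)
open import Data.Vec as Vec using (Vec; lookup)
open import Data.Vec.Properties using (lookup∘tabulate)
open import Data.Nat.Induction using (<-rec)
import Data.List.Membership.DecPropositional as Membership
open import Data.Product using (Σ; ∃-syntax; _×_; _,_; proj₁; proj₂; map₂)
open import Data.Sum using (_⊎_; inj₁; inj₂; [_,_]′)
open import Data.Empty using (⊥; ⊥-elim)
open import Data.Unit using (tt)
open import Function using (_∘_; id; Equivalence)
open import Relation.Nullary using (¬_; Dec; yes; no; contradiction; ⌊_⌋)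
open import Relation.Nullary.Decidable using (toWitness; fromWitness; decidable-stable; ¬?)
open import Relation.Binary.PropositionalEquality

-- Indicator values of Booleans

⟦_⟧ : Bool → ℕ
⟦ true ⟧  = 1
⟦ false ⟧ = 0

⟦⟧-T : ∀ {b} → T b → ⟦ b ⟧ ≡ 1
⟦⟧-T {true} _ = refl

⟦⟧-F : ∀ {b} → ¬ T b → ⟦ b ⟧ ≡ 0
⟦⟧-F {true}  ¬b = contradiction tt ¬b
⟦⟧-F {false} _  = refl

⟦⟧-pos : ∀ {b} → 0 < ⟦ b ⟧ → T b
⟦⟧-pos {true} _ = tt

⟦⟧-mono : ∀ {a b} → (T a → T b) → ⟦ a ⟧ ≤ ⟦ b ⟧
⟦⟧-mono {true}  a⇒b = ≤-reflexive (sym (⟦⟧-T (a⇒b tt)))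
⟦⟧-mono {false} _   = z≤n

¬T⇒T-not : ∀ {b} → ¬ T b → T (not b)
¬T⇒T-not {true}  ¬b = ¬b tt
¬T⇒T-not {false} _  = tt

⟦⟧-not : ∀ b → ⟦ not b ⟧ + ⟦ b ⟧ ≡ 1
⟦⟧-not true  = refl
⟦⟧-not false = refl

⟦⟧-∧ : ∀ a b → ⟦ a ∧ b ⟧ ≡ ⟦ a ⟧ * ⟦ b ⟧
⟦⟧-∧ true  b = sym (+-identityʳ _)
⟦⟧-∧ false b = refl

⟦⟧-∨ : ∀ a b → ¬ (T a × T b) → ⟦ a ∨ b ⟧ ≡ ⟦ a ⟧ + ⟦ b ⟧
⟦⟧-∨ true  b ¬ab = cong suc (sym (⟦⟧-F (λ tb → ¬ab (tt , tb))))
⟦⟧-∨ false b _   = refl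

*-pos⁻ : ∀ m {n} → 0 < m * n → 0 < m × 0 < n
*-pos⁻ (suc m) {suc n} _ = s≤s z≤n , s≤s z≤n
*-pos⁻ (suc m) {zero}  p = contradiction (subst (0 <_) (*-zeroʳ m) p) (λ ())

-- Finite sums over lists

module _ {A : Set} where

  ∑ : List A → (A → ℕ) → ℕ
  ∑ xs f = sum (map f xs)

  ∑-cong : ∀ xs {f g} → (∀ x → f x ≡ g x) → ∑ xs f ≡ ∑ xs g
  ∑-cong []       f≗g = refl
  ∑-cong (x ∷ xs) f≗g = cong₂ _+_ (f≗g x) (∑-cong xs f≗g)

  ∑-mono-∈ : ∀ xs {f g} → (∀ x → x ∈ xs → f x ≤ g x) → ∑ xs f ≤ ∑ xs g
  ∑-mono-∈ []       f≤g = z≤n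
  ∑-mono-∈ (x ∷ xs) f≤g = +-mono-≤ (f≤g x (here refl)) (∑-mono-∈ xs (λ y y∈ → f≤g y (there y∈)))

  ∑-mono : ∀ xs {f g} → (∀ x → f x ≤ g x) → ∑ xs f ≤ ∑ xs g
  ∑-mono xs f≤g = ∑-mono-∈ xs (λ x _ → f≤g x)

  ∑-+ : ∀ xs f g → ∑ xs (λ x → f x + g x) ≡ ∑ xs f + ∑ xs g
  ∑-+ []       f g = refl
  ∑-+ (x ∷ xs) f g = trans (cong (f x + g x +_) (∑-+ xs f g)) (interchange (f x) (g x) _ _)
    where
    interchange : ∀ a b c d → a + b + (c + d) ≡ a + c + (b + d)
    interchange = solve-∀

  ∑-*ˡ : ∀ xs c f → ∑ xs (λ x → c * f x) ≡ c * ∑ xs f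
  ∑-*ˡ []       c f = sym (*-zeroʳ c)
  ∑-*ˡ (x ∷ xs) c f = trans (cong (c * f x +_) (∑-*ˡ xs c f)) (sym (*-distribˡ-+ c (f x) _))

  ∑-*ʳ : ∀ xs c f → ∑ xs (λ x → f x * c) ≡ ∑ xs f * c
  ∑-*ʳ xs c f = trans (∑-cong xs (λ x → *-comm (f x) c)) (trans (∑-*ˡ xs c f) (*-comm c _))

  ∑-const : ∀ xs c → ∑ xs (λ _ → c) ≡ length xs * c
  ∑-const []       c = refl
  ∑-const (x ∷ xs) c = cong (c +_) (∑-const xs c)

  ∑-term : ∀ xs f {x} → x ∈ xs → f x ≤ ∑ xs f
  ∑-term (x ∷ xs) f (here refl) = m≤m+n _ _
  ∑-term (x ∷ xs) f (there x∈)  = ≤-trans (∑-term xs f x∈) (m≤n+m _ _)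

  ∑-pos : ∀ xs f → 0 < ∑ xs f → ∃[ x ] (x ∈ xs × 0 < f x)
  ∑-pos (x ∷ xs) f 0<∑ with f x in fx
  ... | suc _ = x , here refl , subst (0 <_) (sym fx) (s≤s z≤n)
  ... | zero  with y , y∈ , 0<fy ← ∑-pos xs f 0<∑ = y , there y∈ , 0<fy

  -- A maximal term is at least the average. Positivity of the sum excludes the empty list; where
  -- the tail sums to zero, the head is taken.
  ∑-argmax : ∀ xs f → 0 < ∑ xs f → ∃[ x ] (∑ xs f ≤ length xs * f x)
  ∑-argmax (x ∷ xs) f 0<∑ with ∑ xs f in eq
  ... | zero  = x , +-monoʳ-≤ (f x) z≤n
  ... | suc r with y , le ← ∑-argmax xs f (subst (0 <_) (sym eq) (s≤s z≤n)) with ≤-total (f x) (f y)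
  ...   | inj₁ fx≤fy = y , +-mono-≤ fx≤fy (subst (_≤ length xs * f y) eq le)
  ...   | inj₂ fy≤fx = x , +-monoʳ-≤ (f x) (≤-trans (subst (_≤ length xs * f y) eq le) (*-monoʳ-≤ (length xs) fy≤fx))

  length-filter-∑ : ∀ (p : A → Bool) xs → length (filter (λ x → T? (p x)) xs) ≡ ∑ xs (λ x → ⟦ p x ⟧)
  length-filter-∑ p []       = refl
  length-filter-∑ p (x ∷ xs) with p x
  ... | true  = cong suc (length-filter-∑ p xs)
  ... | false = length-filter-∑ p xs

∑-swap : ∀ {A B : Set} (xs : List A) (ys : List B) (f : A → B → ℕ) →
         ∑ xs (λ x → ∑ ys (f x)) ≡ ∑ ys (λ y → ∑ xs (λ x → f x y))
∑-swap []       ys f = sym (trans (∑-const ys 0) (*-zeroʳ (length ys)))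
∑-swap (x ∷ xs) ys f = trans (cong (∑ ys (f x) +_) (∑-swap xs ys f)) (sym (∑-+ ys (f x) _))

-- Sums over all vertices and double counting

∑ᵛ : ∀ {n} → (Fin n → ℕ) → ℕ
∑ᵛ {n} = ∑ (allFin n)

∑ᵛ-suc : ∀ {n} (f : Fin (suc n) → ℕ) → ∑ᵛ f ≡ f zero + ∑ᵛ (f ∘ suc)
∑ᵛ-suc {n} f = cong (λ l → f zero + sum l)
  (trans (map-tabulate suc f) (sym (map-tabulate id (f ∘ suc))))

∑ᵛ-const : ∀ n c → ∑ᵛ {n} (λ _ → c) ≡ n * c
∑ᵛ-const n c = trans (∑-const (allFin n) c) (cong (_* c) (length-tabulate {n = n} id))

∑ᵛ-term : ∀ {n} (f : Fin n → ℕ) x → f x ≤ ∑ᵛ f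
∑ᵛ-term f x = ∑-term (allFin _) f (∈-allFin x)

δ : ∀ {n} → Fin n → Fin n → ℕ
δ u v = ⟦ ⌊ u Fin.≟ v ⌋ ⟧

δ-refl : ∀ {n} (u : Fin n) → δ u u ≡ 1
δ-refl u = ⟦⟧-T (fromWitness {a? = u Fin.≟ u} refl)

∑ᵛ-δ : ∀ {n} (a : Fin n) → ∑ᵛ (δ a) ≡ 1
∑ᵛ-δ {suc n} zero    = trans (∑ᵛ-suc (δ (zero {n}))) (cong suc (trans (∑ᵛ-const n 0) (*-zeroʳ n)))
∑ᵛ-δ {suc n} (suc a) = trans (∑ᵛ-suc (δ (suc a)))
  (trans (∑-cong (allFin n) (λ v → δ-suc v)) (∑ᵛ-δ a))
  where
  δ-suc : ∀ v → δ (suc a) (suc v) ≡ δ a v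
  δ-suc v with a Fin.≟ v
  ... | yes _ = refl
  ... | no _  = refl

-- Double counting in the matrix `δ x v`: each row `x` in `S` sums to one, and column `v` sums to at
-- most `⟦ p v ⟧`, because `S` has no repetitions and lies inside `p`.
unique-length≤∑ : ∀ {n} (p : Fin n → Bool) (S : List (Fin n)) → Unique S → (∀ x → x ∈ S → T (p x)) →
                  length S ≤ ∑ᵛ (λ v → ⟦ p v ⟧)
unique-length≤∑ {n} p S uniq S⊆p = begin
  length S                       ≡⟨ trans (sym (*-identityʳ _)) (sym (∑-const S 1)) ⟩
  ∑ S (λ _ → 1)                  ≡⟨ ∑-cong S (λ x → sym (∑ᵛ-δ x)) ⟩
  ∑ S (λ x → ∑ᵛ (δ x))           ≡⟨ ∑-swap S (allFin n) δ ⟩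
  ∑ᵛ (λ v → ∑ S (λ x → δ x v))   ≤⟨ ∑-mono (allFin n) (λ v → multiplicity v S uniq S⊆p) ⟩
  ∑ᵛ (λ v → ⟦ p v ⟧)             ∎
  where
  open ≤-Reasoning
  absent : ∀ v S → (∀ {x} → x ∈ S → ¬ v ≡ x) → ∑ S (λ x → δ x v) ≡ 0
  absent v []      _  = refl
  absent v (x ∷ S) v∉ with x Fin.≟ v
  ... | yes x≡v = contradiction (sym x≡v) (v∉ (here refl))
  ... | no  _   = absent v S (v∉ ∘ there)
  multiplicity : ∀ v S → Unique S → (∀ x → x ∈ S → T (p x)) → ∑ S (λ x → δ x v) ≤ ⟦ p v ⟧
  multiplicity v []      _            _   = z≤n
  multiplicity v (x ∷ S) (x∉S ∷ uniq) S⊆p with x Fin.≟ v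
  ... | yes refl = ≤-reflexive (trans (cong suc (absent v S (All.lookup x∉S))) (sym (⟦⟧-T (S⊆p v (here refl)))))
  ... | no  _    = multiplicity v S uniq (λ y y∈ → S⊆p y (there y∈))

injection-≤∑ : ∀ {m n} (h : Fin m → Fin n) (p : Fin n → Bool) → (∀ {i j} → h i ≡ h j → i ≡ j) →
               (∀ i → T (p (h i))) → m ≤ ∑ᵛ (λ v → ⟦ p v ⟧)
injection-≤∑ {m} h p inj hp = subst (_≤ _) (trans (length-map h (allFin m)) (length-tabulate {n = m} id))
  (unique-length≤∑ p (map h (allFin m)) (Unique.map⁺ inj (Unique.allFin⁺ m)) image)
  where
  image : ∀ x → x ∈ map h (allFin m) → T (p x)
  image x x∈ with i , _ , refl ← ∈-map⁻ h x∈ = hp i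

-- Double counting of the pairs with `h i ≡ v`: each index contributes one, and each vertex of `p`
-- receives at least one.
∑≤-cover : ∀ {m n} (h : Fin m → Fin n) (p : Fin n → Bool) → (∀ v → T (p v) → ∃[ i ] h i ≡ v) →
           ∑ᵛ (λ v → ⟦ p v ⟧) ≤ m
∑≤-cover {m} {n} h p cov = begin
  ∑ᵛ (λ v → ⟦ p v ⟧)                 ≤⟨ ∑-mono (allFin n) covered ⟩
  ∑ᵛ (λ v → ∑ᵛ (λ i → δ (h i) v))    ≡⟨ ∑-swap (allFin m) (allFin n) (λ i → δ (h i)) ⟨
  ∑ᵛ (λ i → ∑ᵛ (δ (h i)))            ≡⟨ ∑-cong (allFin m) (λ i → ∑ᵛ-δ (h i)) ⟩
  ∑ᵛ (λ (i : Fin m) → 1)             ≡⟨ trans (∑ᵛ-const m 1) (*-identityʳ m) ⟩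
  m                                  ∎
  where
  open ≤-Reasoning
  covered : ∀ v → ⟦ p v ⟧ ≤ ∑ᵛ (λ i → δ (h i) v)
  covered v with p v | cov v
  ... | false | _   = z≤n
  ... | true  | cov′ with i , refl ← cov′ tt =
    ≤-trans (≤-reflexive (sym (δ-refl (h i)))) (∑ᵛ-term (λ j → δ (h j) (h i)) i)

T-∧⁻ : ∀ {a b} → T (a ∧ b) → T a × T b
T-∧⁻ = Equivalence.to T-∧

T-∧⁺ : ∀ {a b} → T a → T b → T (a ∧ b)
T-∧⁺ ta tb = Equivalence.from T-∧ (ta , tb)

T-∨⁻ : ∀ {a b} → T (a ∨ b) → T a ⊎ T b
T-∨⁻ = Equivalence.to T-∨

T-∨⁺ : ∀ {a b} → T a ⊎ T b → T (a ∨ b)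
T-∨⁺ = Equivalence.from T-∨

-- Walks and paths

Walk-++ : ∀ {G x y z ℓ ℓ′} → Walk G x y ℓ → Walk G y z ℓ′ → Walk G x z (ℓ + ℓ′)
Walk-++ here       w′ = w′
Walk-++ (step e w) w′ = step e (Walk-++ w w′)

Adj-sym : ∀ G {x y} → Adj G x y → Adj G y x
Adj-sym G {x} {y} = subst T (Graph.sym G x y)

Walk-sym : ∀ {G x y ℓ} → Walk G x y ℓ → Walk G y x ℓ
Walk-sym here = here
Walk-sym {G} {x} {z} {suc ℓ} (step e w) =
  subst (Walk G z x) (+-comm ℓ 1) (Walk-++ (Walk-sym w) (step (Adj-sym G e) here))

path-walk : ∀ {G} m (c : Fin (suc m) → Fin (n G)) → (∀ i → Adj G (c (inject₁ i)) (c (suc i))) →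
            Walk G (c zero) (c (fromℕ m)) m
path-walk zero    c e = here
path-walk (suc m) c e = step (e zero) (path-walk m (c ∘ suc) (e ∘ suc))

-- Deleting one edge of a path leaves a walk before it and a walk after it. The lengths are added in
-- the order in which a closing edge later joins the second walk to the first.
path-split : ∀ {G} m (c : Fin (suc m) → Fin (n G)) (i : Fin m) →
             (∀ j → ¬ j ≡ i → Adj G (c (inject₁ j)) (c (suc j))) →
             ∃[ ℓ ] ∃[ ℓ′ ] (suc (ℓ′ + ℓ) ≡ m × Walk G (c zero) (c (inject₁ i)) ℓ × Walk G (c (suc i)) (c (fromℕ m)) ℓ′)
path-split (suc m) c zero    e = 0 , m , cong suc (+-identityʳ m) , here , path-walk m (c ∘ suc) (λ j → e (suc j) (λ ()))
path-split (suc m) c (suc i) e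
  with ℓ , ℓ′ , eq , w , w′ ← path-split m (c ∘ suc) i (λ j j≢i → e (suc j) (j≢i ∘ Fin.suc-injective))
  = suc ℓ , ℓ′ , cong suc (trans (+-suc ℓ′ ℓ) eq) , step (e zero (λ ())) w , w′

-- Preserving the girth when far apart vertices are joined

SameEdge : ∀ {V : Set} → V → V → V → V → Set
SameEdge a b x y = (x ≡ a × y ≡ b) ⊎ (x ≡ b × y ≡ a)

SameEdge-unique : ∀ {V : Set} {a b x y x′ y′ : V} → SameEdge a b x y → SameEdge a b x′ y′ → SameEdge x y x′ y′
SameEdge-unique (inj₁ (refl , refl)) s = s
SameEdge-unique (inj₂ (refl , refl)) (inj₁ s) = inj₂ s
SameEdge-unique (inj₂ (refl , refl)) (inj₂ s) = inj₁ s

-- The vertex set is a parameter of the type, so that graphs on the same vertices can be compared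
-- and extended edge by edge.
record GraphOn (N : ℕ) : Set where
  field
    edge        : Fin N → Fin N → Bool
    edge-sym    : ∀ x y → edge x y ≡ edge y x
    edge-irrefl : ∀ x → edge x x ≡ false

open GraphOn

graph : ∀ {N} → GraphOn N → Graph
graph {N} G = record { n = N ; adj = edge G ; sym = edge-sym G ; irrefl = edge-irrefl G }

-- A cycle through the new edge {a, b} closes up a walk between a and b in the old graph.
girth-add-edge : ∀ {N} (G H : GraphOn N) {a b : Fin N} {g} →
                 (∀ x y → T (edge H x y) → T (edge G x y) ⊎ SameEdge a b x y) →
                 (∀ ℓ → ℓ ≤ g → ¬ Walk (graph G) a b ℓ) →
                 GirthAtLeast (graph G) g → GirthAtLeast (graph H) g
girth-add-edge {N} G H {a} {b} {g} new far girth m 3≤m (c , c-inj , c-step , c-close) with g ≤? suc m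
... | yes g≤m = g≤m
... | no  g≰m = ⊥-elim (go (Fin.any? (λ i → ¬? (T? (edge G (c (inject₁ i)) (c (suc i)))))))
  where
  m≤g : m ≤ g
  m≤g = ≤-trans (n≤1+n m) (<⇒≤ (≰⇒> g≰m))

  no-walk : ∀ {x y} → SameEdge a b x y → ¬ Walk (graph G) x y m
  no-walk (inj₁ (refl , refl)) w = far m m≤g w
  no-walk (inj₂ (refl , refl)) w = far m m≤g (Walk-sym w)

  2+i≢i : ∀ i → ¬ suc (suc i) ≡ i
  2+i≢i i eq = 1+n≰n (≤-trans (n≤1+n (suc i)) (≤-reflexive eq))

  others : ∀ i → SameEdge a b (c (inject₁ i)) (c (suc i)) → ∀ j → ¬ j ≡ i → Adj (graph G) (c (inject₁ j)) (c (suc j))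
  others i same j j≢i with new _ _ (c-step j)
  ... | inj₁ old = old
  ... | inj₂ same′ with SameEdge-unique same same′
  ...   | inj₁ (eq , _) = ⊥-elim (j≢i (Fin.inject₁-injective (c-inj eq)))
  -- Traversing the new edge backwards at step `j` would give both `j = i + 1` and `i = j + 1`.
  ...   | inj₂ (eq , eq′) = ⊥-elim (2+i≢i (toℕ i) (begin
    suc (suc (toℕ i))       ≡⟨ cong (suc ∘ toℕ) (c-inj eq) ⟨
    suc (toℕ (inject₁ j))   ≡⟨ cong suc (Fin.toℕ-inject₁ j) ⟩
    suc (toℕ j)             ≡⟨ cong toℕ (c-inj eq′) ⟩
    toℕ (inject₁ i)         ≡⟨ Fin.toℕ-inject₁ i ⟩
    toℕ i                   ∎))
    where open ≡-Reasoning

  closing : ∀ i → SameEdge a b (c (inject₁ i)) (c (suc i)) → Adj (graph G) (c (fromℕ m)) (c zero)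
  closing i same with new _ _ c-close
  ... | inj₁ old = old
  ... | inj₂ same′ with SameEdge-unique same same′
  ...   | inj₁ (eq , _) = ⊥-elim (Fin.fromℕ≢inject₁ (c-inj eq))
  -- If the closing step were the reverse of step `i`, then `i` would be 0 and `m` would be 1, too
  -- short for a cycle.
  ...   | inj₂ (eq , eq′) = ⊥-elim (<⇒≢ (≤-pred 3≤m) (begin
    1                       ≡⟨ cong (suc ∘ toℕ) (c-inj eq′) ⟩
    suc (toℕ (inject₁ i))   ≡⟨ cong suc (Fin.toℕ-inject₁ i) ⟩
    suc (toℕ i)             ≡⟨ cong toℕ (c-inj eq) ⟨
    toℕ (fromℕ m)           ≡⟨ Fin.toℕ-fromℕ m ⟩
    m                       ∎))
    where open ≡-Reasoning

  -- The rest of the cycle runs from `c (suc i)` to the end, over the closing edge to the start, and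
  -- on to `c (inject₁ i)`: a walk of length `m` in the old graph.
  through-new : ∀ i → SameEdge a b (c (inject₁ i)) (c (suc i)) → ⊥
  through-new i same with path-split {graph G} m c i (others i same)
  ... | ℓ , ℓ′ , refl , w , w′ =
    no-walk same (Walk-sym (subst (Walk (graph G) _ _) (+-suc ℓ′ ℓ) (Walk-++ w′ (step (closing i same) w))))

  go : Dec (∃[ i ] ¬ T (edge G (c (inject₁ i)) (c (suc i)))) → ⊥
  go (no all-old) with new _ _ c-close
  ... | inj₁ old  = g≰m (girth m 3≤m (c , c-inj , (λ i → decidable-stable (T? _) (λ ¬e → all-old (i , ¬e))) , old))
  ... | inj₂ same = no-walk same (Walk-sym (path-walk m c (λ i → decidable-stable (T? _) (λ ¬e → all-old (i , ¬e)))))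
  go (yes (i , ¬old)) with new _ _ (c-step i)
  ... | inj₁ old  = ¬old old
  ... | inj₂ same = through-new i same

-- Degrees and numbers of walks

module _ {N : ℕ} where

  deg : GraphOn N → Fin N → ℕ
  deg G u = ∑ᵛ (λ v → ⟦ edge G u v ⟧)

  degree≡deg : ∀ G u → degree (graph G) u ≡ deg G u
  degree≡deg G u = length-filter-∑ (edge G u) (allFin N)

  _⊑_ : GraphOn N → GraphOn N → Set
  G ⊑ H = ∀ {u v} → T (edge G u v) → T (edge H u v)

  deg-mono : ∀ {G H} → G ⊑ H → ∀ u → deg G u ≤ deg H u
  deg-mono G⊑H u = ∑-mono (allFin N) (λ v → ⟦⟧-mono G⊑H)

  Walk-mono : ∀ {G H u v ℓ} → G ⊑ H → Walk (graph G) u v ℓ → Walk (graph H) u v ℓ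
  Walk-mono G⊑H here       = here
  Walk-mono {G} {H} G⊑H (step e w) = step (G⊑H e) (Walk-mono {G} {H} G⊑H w)

  -- Walks of length at most i from u to v, each counted once for every way of padding it to length i.
  walks : GraphOn N → ℕ → Fin N → Fin N → ℕ
  walks G zero    u v = δ u v
  walks G (suc i) u v = walks G i u v + ∑ᵛ (λ w → ⟦ edge G u w ⟧ * walks G i w v)

  walks⇒Walk : ∀ G i {u v} → 0 < walks G i u v → ∃[ ℓ ] Walk (graph G) u v ℓ
  walks⇒Walk G zero    {u} {v} p with u Fin.≟ v
  ... | yes refl = 0 , here
  walks⇒Walk G (suc i) {u} {v} p with walks G i u v in eq
  ... | suc _ = walks⇒Walk G i (subst (0 <_) (sym eq) (s≤s z≤n))
  ... | zero with w , _ , q ← ∑-pos (allFin N) _ p with e , r ← *-pos⁻ _ q with ℓ , uw ← walks⇒Walk G i r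
    = suc ℓ , step (⟦⟧-pos e) uw

  Walk⇒walks : ∀ G i {u v ℓ} → ℓ ≤ i → Walk (graph G) u v ℓ → 0 < walks G i u v
  Walk⇒walks G zero    {u} z≤n here = ≤-reflexive (sym (δ-refl u))
  Walk⇒walks G (suc i) z≤n here = ≤-trans (Walk⇒walks G i z≤n here) (m≤m+n _ _)
  Walk⇒walks G (suc i) {u} {v} (s≤s ℓ≤i) (step {y = w} e w⇝v) = begin
    1                                              ≤⟨ Walk⇒walks G i ℓ≤i w⇝v ⟩
    walks G i w v                                  ≡⟨ trans (sym (+-identityʳ _)) (cong (_* walks G i w v) (sym (⟦⟧-T e))) ⟩
    ⟦ edge G u w ⟧ * walks G i w v                 ≤⟨ ∑ᵛ-term (λ w → ⟦ edge G u w ⟧ * walks G i w v) w ⟩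
    ∑ᵛ (λ w → ⟦ edge G u w ⟧ * walks G i w v)      ≤⟨ m≤n+m _ _ ⟩
    walks G (suc i) u v                            ∎
    where open ≤-Reasoning

  -- This bounds the size of the ball of radius `i`: each unit of length is either padding or one of
  -- at most `Δ` edges, a factor of at most `1 + Δ`.
  ∑-walks≤ : ∀ G Δ → (∀ u → deg G u ≤ Δ) → ∀ i u → ∑ᵛ (walks G i u) ≤ suc Δ ^ i
  ∑-walks≤ G Δ deg≤ zero    u = ≤-reflexive (∑ᵛ-δ u)
  ∑-walks≤ G Δ deg≤ (suc i) u = begin
    ∑ᵛ (λ v → walks G i u v + ∑ᵛ (λ w → ⟦ edge G u w ⟧ * walks G i w v))
      ≡⟨ ∑-+ (allFin N) _ _ ⟩
    ∑ᵛ (walks G i u) + ∑ᵛ (λ v → ∑ᵛ (λ w → ⟦ edge G u w ⟧ * walks G i w v))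
      ≡⟨ cong (∑ᵛ (walks G i u) +_) (∑-swap (allFin N) (allFin N) _) ⟩
    ∑ᵛ (walks G i u) + ∑ᵛ (λ w → ∑ᵛ (λ v → ⟦ edge G u w ⟧ * walks G i w v))
      ≡⟨ cong (∑ᵛ (walks G i u) +_) (∑-cong (allFin N) (λ w → ∑-*ˡ (allFin N) ⟦ edge G u w ⟧ (walks G i w))) ⟩
    ∑ᵛ (walks G i u) + ∑ᵛ (λ w → ⟦ edge G u w ⟧ * ∑ᵛ (walks G i w))
      ≤⟨ +-mono-≤ (∑-walks≤ G Δ deg≤ i u) (∑-mono (allFin N) (λ w → *-monoʳ-≤ ⟦ edge G u w ⟧ (∑-walks≤ G Δ deg≤ i w))) ⟩
    suc Δ ^ i + ∑ᵛ (λ w → ⟦ edge G u w ⟧ * suc Δ ^ i)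
      ≡⟨ cong (suc Δ ^ i +_) (∑-*ʳ (allFin N) (suc Δ ^ i) _) ⟩
    suc Δ ^ i + deg G u * suc Δ ^ i
      ≤⟨ +-monoʳ-≤ (suc Δ ^ i) (*-monoˡ-≤ (suc Δ ^ i) (deg≤ u)) ⟩
    suc Δ ^ suc i ∎
    where open ≤-Reasoning

  both-≟⁻ : ∀ {a b u v : Fin N} → T (⌊ a Fin.≟ u ⌋ ∧ ⌊ b Fin.≟ v ⌋) → u ≡ a × v ≡ b
  both-≟⁻ {a} {b} {u} {v} t with p , q ← T-∧⁻ {⌊ a Fin.≟ u ⌋} t = sym (toWitness p) , sym (toWitness q)

  δ-∧ : ∀ (a b u v : Fin N) → ⟦ ⌊ a Fin.≟ u ⌋ ∧ ⌊ b Fin.≟ v ⌋ ⟧ ≡ δ a u * δ b v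
  δ-∧ a b u v = ⟦⟧-∧ ⌊ a Fin.≟ u ⌋ ⌊ b Fin.≟ v ⌋

  -- Adding one edge and its effect on the degrees

  module AddEdge (G : GraphOn N) (a b : Fin N) (a≢b : ¬ a ≡ b) (¬ab : ¬ T (edge G a b)) where

    private
      ab-edge : Fin N → Fin N → Bool
      ab-edge u v = ⌊ a Fin.≟ u ⌋ ∧ ⌊ b Fin.≟ v ⌋ ∨ ⌊ b Fin.≟ u ⌋ ∧ ⌊ a Fin.≟ v ⌋

      ab-edge⇒SameEdge : ∀ u v → T (ab-edge u v) → SameEdge a b u v
      ab-edge⇒SameEdge u v t with T-∨⁻ {⌊ a Fin.≟ u ⌋ ∧ ⌊ b Fin.≟ v ⌋} t
      ... | inj₁ s = inj₁ (both-≟⁻ s)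
      ... | inj₂ s = inj₂ (both-≟⁻ s)

    newEdge : Fin N → Fin N → Bool
    newEdge u v = edge G u v ∨ ab-edge u v

    newEdge⁻ : ∀ u v → T (newEdge u v) → T (edge G u v) ⊎ SameEdge a b u v
    newEdge⁻ u v t with T-∨⁻ {edge G u v} t
    ... | inj₁ old  = inj₁ old
    ... | inj₂ new = inj₂ (ab-edge⇒SameEdge u v new)

    private
      irreflexive : ∀ x → newEdge x x ≡ false
      irreflexive x with newEdge x x | newEdge⁻ x x
      ... | false | _ = refl
      ... | true  | split with split tt
      ...   | inj₁ xx = ⊥-elim (subst T (edge-irrefl G x) xx)
      ...   | inj₂ (inj₁ (refl , x≡b)) = contradiction x≡b a≢b
      ...   | inj₂ (inj₂ (refl , x≡a)) = contradiction (sym x≡a) a≢b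

      symmetric : ∀ x y → newEdge x y ≡ newEdge y x
      symmetric x y = cong₂ _∨_ (edge-sym G x y)
        (trans (∨-comm (⌊ a Fin.≟ x ⌋ ∧ ⌊ b Fin.≟ y ⌋) _)
               (cong₂ _∨_ (∧-comm ⌊ b Fin.≟ x ⌋ _) (∧-comm ⌊ a Fin.≟ x ⌋ _)))

    G+ab : GraphOn N
    G+ab = record { edge = newEdge ; edge-sym = symmetric ; edge-irrefl = irreflexive }

    G⊑G+ab : G ⊑ G+ab
    G⊑G+ab e = T-∨⁺ (inj₁ e)

    ab∈G+ab : T (edge G+ab a b)
    ab∈G+ab = T-∨⁺ {edge G a b} (inj₂ (T-∨⁺ (inj₁ (T-∧⁺ {⌊ a Fin.≟ a ⌋} (fromWitness refl) (fromWitness refl)))))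

    -- The disjuncts exclude each other, because `a` and `b` differ and are not yet adjacent. The
    -- indicator is therefore an exact sum, and so are the degrees derived from it.
    ⟦newEdge⟧ : ∀ u v → ⟦ newEdge u v ⟧ ≡ ⟦ edge G u v ⟧ + (δ a u * δ b v + δ b u * δ a v)
    ⟦newEdge⟧ u v = trans (⟦⟧-∨ (edge G u v) _ disjoint)
      (cong (⟦ edge G u v ⟧ +_) (trans (⟦⟧-∨ (⌊ a Fin.≟ u ⌋ ∧ ⌊ b Fin.≟ v ⌋) _ disjoint′)
        (cong₂ _+_ (δ-∧ a b u v) (δ-∧ b a u v))))
      where
      disjoint : ¬ (T (edge G u v) × T (ab-edge u v))
      disjoint (e , s) with ab-edge⇒SameEdge u v s
      ... | inj₁ (refl , refl) = ¬ab e
      ... | inj₂ (refl , refl) = ¬ab (Adj-sym (graph G) e)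
      disjoint′ : ¬ (T (⌊ a Fin.≟ u ⌋ ∧ ⌊ b Fin.≟ v ⌋) × T (⌊ b Fin.≟ u ⌋ ∧ ⌊ a Fin.≟ v ⌋))
      disjoint′ (s , s′) = a≢b (trans (sym (proj₁ (both-≟⁻ s))) (proj₁ (both-≟⁻ s′)))

    deg-G+ab : ∀ u → deg G+ab u ≡ deg G u + (δ a u + δ b u)
    deg-G+ab u = begin
      deg G+ab u
        ≡⟨ trans (∑-cong (allFin N) (⟦newEdge⟧ u)) (∑-+ (allFin N) _ _) ⟩
      deg G u + ∑ᵛ (λ v → δ a u * δ b v + δ b u * δ a v)
        ≡⟨ cong (deg G u +_) (trans (∑-+ (allFin N) _ _)
             (cong₂ _+_ (∑-*ˡ (allFin N) (δ a u) (δ b)) (∑-*ˡ (allFin N) (δ b u) (δ a)))) ⟩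
      deg G u + (δ a u * ∑ᵛ (δ b) + δ b u * ∑ᵛ (δ a))
        ≡⟨ cong (deg G u +_) (cong₂ _+_ (unit (δ a u) b) (unit (δ b u) a)) ⟩
      deg G u + (δ a u + δ b u) ∎
      where
      open ≡-Reasoning
      unit : ∀ x c → x * ∑ᵛ (δ c) ≡ x
      unit x c = trans (cong (x *_) (∑ᵛ-δ c)) (*-identityʳ x)

    deg-a : deg G+ab a ≡ suc (deg G a)
    deg-a = trans (deg-G+ab a) (trans (cong (deg G a +_) (cong₂ _+_ (δ-refl a) (⟦⟧-F (λ e → a≢b (sym (toWitness e)))))) (+-comm _ 1))

    ∑-deg-G+ab : ∑ᵛ (deg G+ab) ≡ ∑ᵛ (deg G) + 2
    ∑-deg-G+ab = trans (∑-cong (allFin N) deg-G+ab) (trans (∑-+ (allFin N) _ _)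
      (cong (∑ᵛ (deg G) +_) (trans (∑-+ (allFin N) _ _) (cong₂ _+_ (∑ᵛ-δ a) (∑ᵛ-δ b)))))

    deg-G+ab≤ : ∀ {Δ} → (∀ u → deg G u ≤ Δ) → deg G a < Δ → deg G b < Δ → ∀ u → deg G+ab u ≤ Δ
    deg-G+ab≤ {Δ} deg≤ a< b< u = subst (_≤ Δ) (sym (deg-G+ab u)) (bound (a Fin.≟ u) (b Fin.≟ u))
      where
      bound : (p : Dec (a ≡ u)) (q : Dec (b ≡ u)) → deg G u + (⟦ ⌊ p ⌋ ⟧ + ⟦ ⌊ q ⌋ ⟧) ≤ Δ
      bound (yes refl) (yes b≡a) = contradiction (sym b≡a) a≢b
      bound (yes refl) (no _)    = subst (_≤ Δ) (+-comm 1 _) a<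
      bound (no _)     (yes refl) = subst (_≤ Δ) (+-comm 1 _) b<
      bound (no _)     (no _)    = subst (_≤ Δ) (sym (+-identityʳ _)) (deg≤ u)

-- Numerical estimates: Markov, Bernoulli and exponential decay

saturation≤ : ∀ {N} (f : Fin N → ℕ) Δ t → .{{_ : NonZero Δ}} → ∑ᵛ f ≤ Δ * t → ∑ᵛ (λ v → ⟦ not (f v <ᵇ Δ) ⟧) ≤ t
saturation≤ {N} f Δ t ∑f≤ = *-cancelˡ-≤ Δ (begin
  Δ * ∑ᵛ (λ v → ⟦ not (f v <ᵇ Δ) ⟧)     ≡⟨ ∑-*ˡ (allFin N) Δ _ ⟨
  ∑ᵛ (λ v → Δ * ⟦ not (f v <ᵇ Δ) ⟧)     ≤⟨ ∑-mono (allFin N) saturated ⟩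
  ∑ᵛ f                                  ≤⟨ ∑f≤ ⟩
  Δ * t                                 ∎)
  where
  open ≤-Reasoning
  saturated : ∀ v → Δ * ⟦ not (f v <ᵇ Δ) ⟧ ≤ f v
  saturated v with f v <ᵇ Δ in eq
  ... | true  = ≤-trans (≤-reflexive (*-zeroʳ Δ)) z≤n
  ... | false = ≤-trans (≤-reflexive (*-identityʳ Δ)) (≮⇒≥ (λ f<Δ → subst T eq (<⇒<ᵇ f<Δ)))

-- Bernoulli's inequality `(1 + 1/p)^n ≥ 1 + n/p` with cleared denominators.
bernoulli : ∀ p n → p ^ n * (p + n) ≤ suc p ^ n * p
bernoulli p zero    = ≤-reflexive (cong (λ x → 1 * x) (+-identityʳ p))
bernoulli p (suc n) = begin
  p * p ^ n * (p + suc n)                       ≤⟨ m≤m+n _ (p ^ n * n) ⟩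
  p * p ^ n * (p + suc n) + p ^ n * n           ≡⟨ regroup p (p ^ n) n ⟩
  suc p * (p ^ n * (p + n))                     ≤⟨ *-monoʳ-≤ (suc p) (bernoulli p n) ⟩
  suc p * (suc p ^ n * p)                       ≡⟨ *-assoc (suc p) (suc p ^ n) p ⟨
  suc p ^ suc n * p                             ∎
  where
  open ≤-Reasoning
  regroup : ∀ p x n → p * x * (p + suc n) + x * n ≡ suc p * (x * (p + n))
  regroup = solve-∀

-- The case `n = p` of Bernoulli's inequality: `(1 + 1/p)^p ≥ 2`.
doubling : ∀ p → .{{_ : NonZero p}} → 2 * p ^ p ≤ suc p ^ p
doubling p = *-cancelʳ-≤ (2 * p ^ p) (suc p ^ p) p (≤-trans (≤-reflexive (regroup p (p ^ p))) (bernoulli p p))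
  where
  regroup : ∀ p x → 2 * x * p ≡ x * (p + p)
  regroup = solve-∀

^-distribʳ-* : ∀ m n o → (m * n) ^ o ≡ m ^ o * n ^ o
^-distribʳ-* m n zero    = refl
^-distribʳ-* m n (suc o) = trans (cong (m * n *_) (^-distribʳ-* m n o)) (interchange m n (m ^ o) (n ^ o))
  where
  interchange : ∀ a b c d → a * b * (c * d) ≡ a * c * (b * d)
  interchange = solve-∀

doubling^ : ∀ p → .{{_ : NonZero p}} → ∀ n → 2 ^ n * p ^ (p * n) ≤ suc p ^ (p * n)
doubling^ p n = begin
  2 ^ n * p ^ (p * n)     ≡⟨ cong (2 ^ n *_) (^-*-assoc p p n) ⟨
  2 ^ n * (p ^ p) ^ n     ≡⟨ ^-distribʳ-* 2 (p ^ p) n ⟨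
  (2 * p ^ p) ^ n         ≤⟨ ^-monoˡ-≤ n (doubling p) ⟩
  (suc p ^ p) ^ n         ≡⟨ ^-*-assoc (suc p) p n ⟩
  suc p ^ (p * n)         ∎
  where open ≤-Reasoning

-- Shrinking `p * suc n` times by the factor `p / (p + 1)` divides by at least `2 ^ suc n`. This
-- brings `y ≤ 2 ^ n` below one, so the natural number `x` vanishes.
decay⇒0 : ∀ p → .{{_ : NonZero p}} → ∀ n {x y} → y ≤ 2 ^ n →
          suc p ^ (p * suc n) * x ≤ p ^ (p * suc n) * y → x ≡ 0
decay⇒0 p n {zero}  {y} y≤ decay = refl
decay⇒0 p n {suc x} {y} y≤ decay = contradiction (begin-strict
  P * 2 ^ n                     <⟨ *-monoʳ-< P {{m^n≢0 p (p * suc n)}} (^-monoʳ-< 2 ≤-refl (n<1+n n)) ⟩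
  P * 2 ^ suc n                 ≡⟨ *-comm P _ ⟩
  2 ^ suc n * P                 ≤⟨ doubling^ p (suc n) ⟩
  suc p ^ (p * suc n)           ≤⟨ m≤m*n _ (suc x) ⟩
  suc p ^ (p * suc n) * suc x   ≤⟨ decay ⟩
  P * y                         ≤⟨ *-monoʳ-≤ P y≤ ⟩
  P * 2 ^ n                     ∎) (<-irrefl refl)
  where
  open ≤-Reasoning
  P = p ^ (p * suc n)

-- Vertex sets as bit vectors

subsets : ∀ n → List (Vec Bool n)
subsets zero    = Vec.[] ∷ []
subsets (suc n) = map (true Vec.∷_) (subsets n) ++ map (false Vec.∷_) (subsets n)

∈-subsets : ∀ {n} (X : Vec Bool n) → X ∈ subsets n
∈-subsets Vec.[]          = here refl
∈-subsets (true  Vec.∷ X) = ∈-++⁺ˡ (∈-map⁺ _ (∈-subsets X))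
∈-subsets (false Vec.∷ X) = ∈-++⁺ʳ _ (∈-map⁺ _ (∈-subsets X))

length-subsets : ∀ n → length (subsets n) ≡ 2 ^ n
length-subsets zero    = refl
length-subsets (suc n) = trans (length-++ (map (true Vec.∷_) (subsets n)))
  (cong₂ _+_ (half true) (trans (half false) (sym (+-identityʳ _))))
  where
  half : ∀ b → length (map (b Vec.∷_) (subsets n)) ≡ 2 ^ n
  half b = trans (length-map _ (subsets n)) (length-subsets n)

-- Augmenting a base graph by edges between far apart leaves

module Augmentation {N : ℕ} (B : GraphOn N) (leaf : Fin N → Bool) (g Δ t : ℕ)
                    {{_ : NonZero Δ}} (0<g : 0 < g) (ball≤t : suc Δ ^ g ≤ t) where

  -- Together, `base⊑` and `new-edge` freeze the neighbourhood of every vertex that is not a leaf;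
  -- this will keep the centres of the stars far apart.
  record Augmented (G : GraphOn N) : Set where
    field
      base⊑ : B ⊑ G
      new-edge : ∀ {u v} → T (edge G u v) → T (edge B u v) ⊎ (T (leaf u) × T (leaf v))
      girth : GirthAtLeast (graph G) g

  -- The number `D` is a running budget: each new edge raises the degree sum by 2, and while
  -- `D ≤ Δ * t` at most `t` vertices are saturated.
  record Sparse (G : GraphOn N) (D : ℕ) : Set where
    field
      augmented : Augmented G
      deg≤ : ∀ u → deg G u ≤ Δ
      ∑deg≤ : ∑ᵛ (deg G) ≤ D

  open Augmented public
  open Sparse public

  relax : ∀ {G D D′} → D ≤ D′ → Sparse G D → Sparse G D′
  relax D≤D′ S = record { augmented = augmented S ; deg≤ = deg≤ S ; ∑deg≤ = ≤-trans (∑deg≤ S) D≤D′ }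

  -- `Q` is the property maintained along a sequence of extensions, `R` what this particular
  -- extension achieves.
  record Extension (G : GraphOn N) (Q R : GraphOn N → Set) : Set where
    constructor extension
    field
      {H} : GraphOn N
      G⊑H : G ⊑ H
      invariant : Q H
      gain : R H

  -- Sequential composition. The gain of the first extension is handed to the continuation, which
  -- must itself transport whatever has to survive in the larger graph.
  _then_ : ∀ {G Q R Q′ R′} → Extension G Q R → (∀ {H} → G ⊑ H → Q H → R H → Extension H Q′ R′) → Extension G Q′ R′
  extension G⊑H q r then f with f G⊑H q r
  ... | extension H⊑K q′ r′ = extension (H⊑K ∘ G⊑H) q′ r′

  SparseExtension : GraphOn N → ℕ → (GraphOn N → Set) → Set
  SparseExtension G D = Extension G (λ H → Sparse H D)

  -- Distance greater than `g`, phrased by a walk count so that it is decidable and fits into the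
  -- counting arguments.
  Far : GraphOn N → Fin N → Fin N → Set
  Far G u v = walks G g u v ≡ 0

  far⇒no-walk : ∀ G {u v} → Far G u v → ∀ ℓ → ℓ ≤ g → ¬ Walk (graph G) u v ℓ
  far⇒no-walk G far ℓ ℓ≤g w = contradiction (subst (0 <_) far (Walk⇒walks G g ℓ≤g w)) (λ ())

  far⇒≢ : ∀ G {u v} → Far G u v → ¬ u ≡ v
  far⇒≢ G far refl = far⇒no-walk G far 0 z≤n here

  far⇒¬edge : ∀ G {u v} → Far G u v → ¬ T (edge G u v)
  far⇒¬edge G far e = far⇒no-walk G far 1 0<g (step e here)

  module Join (G : GraphOn N) {u v : Fin N} (far : Far G u v) where
    open AddEdge G u v (far⇒≢ G far) (far⇒¬edge G far) public

    join-augmented : T (leaf u) → T (leaf v) → Augmented G → Augmented G+ab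
    join-augmented lu lv A = record
      { base⊑    = G⊑G+ab ∘ base⊑ A
      ; new-edge = λ {x} {y} e → split (newEdge⁻ x y e)
      ; girth    = girth-add-edge G G+ab newEdge⁻ (far⇒no-walk G far) (girth A)
      }
      where
      split : ∀ {x y} → T (edge G x y) ⊎ SameEdge u v x y → T (edge B x y) ⊎ (T (leaf x) × T (leaf y))
      split (inj₁ old) = new-edge A old
      split (inj₂ (inj₁ (refl , refl))) = inj₂ (lu , lv)
      split (inj₂ (inj₂ (refl , refl))) = inj₂ (lv , lu)

  good : GraphOn N → Fin N → Bool
  good G v = leaf v ∧ (deg G v <ᵇ Δ)

  good⁻ : ∀ G {v} → T (good G v) → T (leaf v) × deg G v < Δ
  good⁻ G {v} t with l , d ← T-∧⁻ {leaf v} t = l , <ᵇ⇒< (deg G v) Δ d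

  join-sparse : ∀ {G D u v} → Sparse G D → T (good G u) → T (good G v) → Far G u v →
                SparseExtension G (D + 2) (λ H → T (edge H u v) × deg H u ≡ suc (deg G u))
  join-sparse {G} {D} {u} {v} S gu gv far = extension G⊑G+ab (record
      { augmented = join-augmented (proj₁ u-good) (proj₁ v-good) (augmented S)
      ; deg≤      = deg-G+ab≤ (deg≤ S) (proj₂ u-good) (proj₂ v-good)
      ; ∑deg≤     = subst (_≤ D + 2) (sym ∑-deg-G+ab) (+-monoˡ-≤ 2 (∑deg≤ S))
      }) (ab∈G+ab , deg-a)
    where
    open Join G far
    u-good : T (leaf u) × deg G u < Δ
    u-good = good⁻ G gu
    v-good : T (leaf v) × deg G v < Δ
    v-good = good⁻ G gv

  -- Many far apart pairs of unsaturated leaves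

  leaves : (Fin N → Bool) → ℕ
  leaves X = ∑ᵛ (λ v → ⟦ leaf v ∧ X v ⟧)

  -- Of the 3t leaves in X, at most t are saturated and at most t lie in the ball of radius g around u.
  module Candidates {G : GraphOn N} {D : ℕ} (S : Sparse G D) (D≤ : D ≤ Δ * t)
                    (X : Fin N → Bool) (large : 3 * t ≤ leaves X) where

    candidate : Fin N → ℕ
    candidate v = ⟦ good G v ∧ X v ⟧

    far : Fin N → Fin N → ℕ
    far u v = ⟦ ⌊ walks G g u v ≟ 0 ⌋ ⟧

    many-candidates : 2 * t ≤ ∑ᵛ candidate
    many-candidates = +-cancelʳ-≤ t _ _ (begin
      2 * t + t                                                    ≡⟨ +-comm (2 * t) t ⟩
      3 * t                                                        ≤⟨ large ⟩
      leaves X                                                     ≤⟨ ∑-mono (allFin N) split ⟩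
      ∑ᵛ (λ v → candidate v + ⟦ not (deg G v <ᵇ Δ) ⟧)              ≡⟨ ∑-+ (allFin N) _ _ ⟩
      ∑ᵛ candidate + ∑ᵛ (λ v → ⟦ not (deg G v <ᵇ Δ) ⟧)             ≤⟨ +-monoʳ-≤ _ (saturation≤ (deg G) Δ t (≤-trans (∑deg≤ S) D≤)) ⟩
      ∑ᵛ candidate + t                                             ∎)
      where
      open ≤-Reasoning
      split : ∀ v → ⟦ leaf v ∧ X v ⟧ ≤ candidate v + ⟦ not (deg G v <ᵇ Δ) ⟧
      split v with leaf v | X v | deg G v <ᵇ Δ
      ... | false | _     | _     = z≤n
      ... | true  | false | _     = z≤n
      ... | true  | true  | true  = s≤s z≤n
      ... | true  | true  | false = s≤s z≤n

    many-far-candidates : ∀ u → t ≤ ∑ᵛ (λ v → candidate v * far u v)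
    many-far-candidates u = +-cancelʳ-≤ t _ _ (begin
      t + t                                                   ≡⟨ cong (t +_) (+-identityʳ t) ⟨
      2 * t                                                   ≤⟨ many-candidates ⟩
      ∑ᵛ candidate                                            ≤⟨ ∑-mono (allFin N) split ⟩
      ∑ᵛ (λ v → candidate v * far u v + walks G g u v)        ≡⟨ ∑-+ (allFin N) _ _ ⟩
      ∑ᵛ (λ v → candidate v * far u v) + ∑ᵛ (walks G g u)     ≤⟨ +-monoʳ-≤ _ (≤-trans (∑-walks≤ G Δ (deg≤ S) g u) ball≤t) ⟩
      ∑ᵛ (λ v → candidate v * far u v) + t                    ∎)
      where
      open ≤-Reasoning
      split : ∀ v → candidate v ≤ candidate v * far u v + walks G g u v
      split v with good G v ∧ X v | walks G g u v
      ... | false | _     = z≤n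
      ... | true  | zero  = s≤s z≤n
      ... | true  | suc _ = s≤s z≤n

    many-pairs : t * t ≤ ∑ᵛ (λ u → ∑ᵛ (λ v → candidate u * (candidate v * far u v)))
    many-pairs = begin
      t * t                                                              ≤⟨ *-monoˡ-≤ t (≤-trans (m≤m+n t _) many-candidates) ⟩
      ∑ᵛ candidate * t                                                   ≡⟨ ∑-*ʳ (allFin N) t candidate ⟨
      ∑ᵛ (λ u → candidate u * t)                                         ≤⟨ ∑-mono (allFin N) (λ u → *-monoʳ-≤ (candidate u) (many-far-candidates u)) ⟩
      ∑ᵛ (λ u → candidate u * ∑ᵛ (λ v → candidate v * far u v))          ≡⟨ ∑-cong (allFin N) (λ u → ∑-*ˡ (allFin N) (candidate u) _) ⟨
      ∑ᵛ (λ u → ∑ᵛ (λ v → candidate u * (candidate v * far u v)))        ∎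
      where open ≤-Reasoning

  0<t : 0 < t
  0<t = ≤-trans (m^n>0 (suc Δ) g) ball≤t

  -- Destroying the large independent sets of leaves

  Family : Set
  Family = List (Vec Bool N)

  Large : Family → Set
  Large F = ∀ X → X ∈ F → 3 * t ≤ leaves (lookup X)

  -- The positive form of not being independent.
  Hit : GraphOn N → Vec Bool N → Set
  Hit G X = ∃[ u ] ∃[ v ] (T (lookup X u) × T (lookup X v) × T (edge G u v))

  Hit-mono : ∀ {G H X} → G ⊑ H → Hit G X → Hit H X
  Hit-mono G⊑H (u , v , Xu , Xv , e) = u , v , Xu , Xv , G⊑H e

  both : Fin N → Fin N → Vec Bool N → Bool
  both u v X = lookup X u ∧ lookup X v

  record PopularPair (G : GraphOn N) (F : Family) (q : ℕ) : Set where
    constructor popular-pair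
    field
      {u v}    : Fin N
      u-good   : T (good G u)
      v-good   : T (good G v)
      u-v-far  : Far G u v
      popular  : length F ≤ q * ∑ F (λ X → ⟦ both u v X ⟧)

  -- Averaging: each set of `F` contains at least `t * t` admissible pairs, and there are only
  -- `N * N ≤ q * (t * t)` pairs in all. Hence some admissible pair lies in at least a fraction
  -- `1/q` of the sets.
  find-popular-pair : ∀ {G D} (F : Family) {q} → Sparse G D → D ≤ Δ * t → N * N ≤ q * (t * t) → Large F → 0 < length F →
                      PopularPair G F q
  find-popular-pair {G} {D} F {q} S D≤ N²≤ large 0<F = select
    where
    open ≤-Reasoning
    candidate : Vec Bool N → Fin N → ℕ
    candidate X v = ⟦ good G v ∧ lookup X v ⟧
    far : Fin N → Fin N → ℕ
    far u v = ⟦ ⌊ walks G g u v ≟ 0 ⌋ ⟧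
    h : Fin N → Fin N → Vec Bool N → ℕ
    h u v X = candidate X u * (candidate X v * far u v)
    total : length F * (t * t) ≤ ∑ᵛ (λ u → ∑ᵛ (λ v → ∑ F (h u v)))
    total = begin
      length F * (t * t)                             ≡⟨ ∑-const F (t * t) ⟨
      ∑ F (λ _ → t * t)                              ≤⟨ ∑-mono-∈ F (λ X X∈ → Candidates.many-pairs S D≤ (lookup X) (large X X∈)) ⟩
      ∑ F (λ X → ∑ᵛ (λ u → ∑ᵛ (λ v → h u v X)))      ≡⟨ ∑-swap F (allFin N) _ ⟩
      ∑ᵛ (λ u → ∑ F (λ X → ∑ᵛ (λ v → h u v X)))      ≡⟨ ∑-cong (allFin N) (λ u → ∑-swap F (allFin N) (λ X v → h u v X)) ⟩
      ∑ᵛ (λ u → ∑ᵛ (λ v → ∑ F (h u v)))              ∎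
    0<tt : 0 < t * t
    0<tt = *-mono-≤ 0<t 0<t
    0<total : 0 < ∑ᵛ (λ u → ∑ᵛ (λ v → ∑ F (h u v)))
    0<total = ≤-trans (*-mono-≤ 0<F 0<tt) total
    argmax : ∀ (f : Fin N → ℕ) → 0 < ∑ᵛ f → ∃[ x ] (∑ᵛ f ≤ N * f x)
    argmax f p with x , le ← ∑-argmax (allFin N) f p = x , subst (λ m → ∑ᵛ f ≤ m * f x) (length-tabulate {n = N} id) le
    pos : ∀ {x y} → 0 < x → x ≤ N * y → 0 < y
    pos p le = proj₂ (*-pos⁻ N (≤-trans p le))
    h≤both : ∀ u v X → h u v X ≤ ⟦ both u v X ⟧
    h≤both u v X with good G u | lookup X u | good G v | lookup X v | ⌊ walks G g u v ≟ 0 ⌋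
    ... | false | _     | _     | _     | _     = z≤n
    ... | true  | false | _     | _     | _     = z≤n
    ... | true  | true  | false | _     | _     = z≤n
    ... | true  | true  | true  | false | _     = z≤n
    ... | true  | true  | true  | true  | false = z≤n
    ... | true  | true  | true  | true  | true  = ≤-refl
    regroup : ∀ q x e → q * x * e ≡ q * e * x
    regroup = solve-∀
    bound : ∀ u v → ∑ᵛ (λ u → ∑ᵛ (λ v → ∑ F (h u v))) ≤ N * ∑ᵛ (λ v → ∑ F (h u v)) →
            ∑ᵛ (λ v → ∑ F (h u v)) ≤ N * ∑ F (h u v) → length F ≤ q * ∑ F (λ X → ⟦ both u v X ⟧)
    bound u v maxᵘ maxᵛ = *-cancelʳ-≤ (length F) (q * e) (t * t) {{>-nonZero 0<tt}} (begin
      length F * (t * t)                       ≤⟨ total ⟩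
      ∑ᵛ (λ u → ∑ᵛ (λ v → ∑ F (h u v)))        ≤⟨ maxᵘ ⟩
      N * ∑ᵛ (λ v → ∑ F (h u v))               ≤⟨ *-monoʳ-≤ N maxᵛ ⟩
      N * (N * ∑ F (h u v))                    ≤⟨ *-monoʳ-≤ N (*-monoʳ-≤ N (∑-mono F (h≤both u v))) ⟩
      N * (N * e)                              ≡⟨ *-assoc N N e ⟨
      N * N * e                                ≤⟨ *-monoˡ-≤ e N²≤ ⟩
      q * (t * t) * e                          ≡⟨ regroup q (t * t) e ⟩
      q * e * (t * t)                          ∎)
      where
      e = ∑ F (λ X → ⟦ both u v X ⟧)
    select : PopularPair G F q
    select
      with u , maxᵘ ← argmax _ 0<total
      with v , maxᵛ ← argmax (λ v → ∑ F (h u v)) (pos 0<total maxᵘ)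
      -- A set `X` with a nonzero term certifies that the chosen pair is admissible.
      with X , _ , 0<h ← ∑-pos F (h u v) (pos (pos 0<total maxᵘ) maxᵛ)
      with cu , rest ← *-pos⁻ (candidate X u) 0<h
      with cv , fuv ← *-pos⁻ (candidate X v) rest
      = popular-pair (proj₁ (T-∧⁻ {good G u} (⟦⟧-pos cu))) (proj₁ (T-∧⁻ {good G v} (⟦⟧-pos cv)))
                     (toWitness (⟦⟧-pos fuv)) (bound u v maxᵘ maxᵛ)

  Reduces : GraphOn N → Family → Family → Set
  Reduces H F F′ = ∀ X → X ∈ F → X ∈ F′ ⊎ Hit H X

  -- The fraction `b / a` bounds the factor by which the family shrinks; every set that was dropped
  -- is hit.
  record Reduction (F : Family) (a b : ℕ) (H : GraphOn N) : Set where
    constructor reduction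
    field
      F′      : Family
      large   : Large F′
      reduces : Reduces H F F′
      shrinks : a * length F′ ≤ b * length F

  module _ {p : ℕ} (N²≤ : N * N ≤ suc p * (t * t)) where

    missing? : ∀ u v (X : Vec Bool N) → Dec (T (not (both u v X)))
    missing? u v X = T? (not (both u v X))

    missing : Fin N → Fin N → Family → Family
    missing u v = filter (missing? u v)

    missing-reduces : ∀ {H} u v F → T (edge H u v) → Reduces H F (missing u v F)
    missing-reduces u v F uv X X∈ with T? (both u v X)
    ... | yes uv∈X with Xu , Xv ← T-∧⁻ {lookup X u} uv∈X = inj₂ (u , v , Xu , Xv , uv)
    ... | no  uv∉X = inj₁ (∈-filter⁺ (missing? u v) X∈ (¬T⇒T-not uv∉X))

    -- At least a fraction `1 / (p + 1)` of the sets contain both ends of the new edge, so at most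
    -- `p / (p + 1)` of the family remains.
    missing-shrinks : ∀ u v F → length F ≤ suc p * ∑ F (λ X → ⟦ both u v X ⟧) →
                      suc p * length (missing u v F) ≤ p * length F
    missing-shrinks u v F popular = +-cancelʳ-≤ (length F) _ _ (begin
      suc p * length F′ + length F        ≤⟨ +-monoʳ-≤ (suc p * length F′) popular ⟩
      suc p * length F′ + suc p * e       ≡⟨ *-distribˡ-+ (suc p) (length F′) e ⟨
      suc p * (length F′ + e)             ≡⟨ cong (suc p *_) partition ⟩
      length F + p * length F             ≡⟨ +-comm (length F) _ ⟩
      p * length F + length F             ∎)
      where
      open ≤-Reasoning
      e = ∑ F (λ X → ⟦ both u v X ⟧)
      F′ = missing u v F
      partition : length F′ + e ≡ length F
      partition = begin-equality
        length F′ + e                                        ≡⟨ cong (_+ e) (length-filter-∑ (λ X → not (both u v X)) F) ⟩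
        ∑ F (λ X → ⟦ not (both u v X) ⟧) + e                 ≡⟨ ∑-+ F _ _ ⟨
        ∑ F (λ X → ⟦ not (both u v X) ⟧ + ⟦ both u v X ⟧)    ≡⟨ ∑-cong F (λ X → ⟦⟧-not (both u v X)) ⟩
        ∑ F (λ _ → 1)                                        ≡⟨ trans (∑-const F 1) (*-identityʳ _) ⟩
        length F                                             ∎

    missing-reduction : ∀ {H} F {u v} → Large F → length F ≤ suc p * ∑ F (λ X → ⟦ both u v X ⟧) →
                        T (edge H u v) → Reduction F (suc p) p H
    missing-reduction {H} F {u} {v} large popular uv =
      reduction (missing u v F) (λ X X∈ → large X (proj₁ (∈-filter⁻ (missing? u v) {xs = F} X∈)))
                (missing-reduces {H} u v F uv) (missing-shrinks u v F popular)

    hit-nonempty : ∀ {G D} F → 0 < length F → Sparse G D → D ≤ Δ * t → Large F →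
                   SparseExtension G (D + 2) (Reduction F (suc p) p)
    hit-nonempty {G} F 0<F S D≤ large = hit (find-popular-pair F S D≤ N²≤ large 0<F)
      where
      hit : PopularPair G F (suc p) → SparseExtension G _ (Reduction F (suc p) p)
      hit (popular-pair gu gv far popular) = join-sparse S gu gv far then λ _ S′ (uv , _) →
        extension id S′ (missing-reduction F large popular uv)

    hit-step : ∀ {G D} F → Sparse G D → D ≤ Δ * t → Large F → SparseExtension G (D + 2) (Reduction F (suc p) p)
    -- An empty family gets no edge, but is charged for one so that all steps have the same cost.
    hit-step {G} {D} [] S _ large = extension id (relax (m≤m+n D 2) S)
      (reduction [] large (λ _ ()) (≤-reflexive (trans (*-zeroʳ (suc p)) (sym (*-zeroʳ p)))))
    hit-step F@(_ ∷ _) = hit-nonempty F (s≤s z≤n)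

    private
      one-more : ∀ D i → D + 2 + 2 * i ≡ D + 2 * suc i
      one-more = solve-∀

    Reduction-trans : ∀ {F a b c d G H} → G ⊑ H → (r : Reduction F a b G) → Reduction (Reduction.F′ r) c d H →
                      Reduction F (a * c) (b * d) H
    Reduction-trans {F} {a} {b} {c} {d} {G} {H} G⊑H (reduction F′ _ reduces shrinks) (reduction F″ large reduces′ shrinks′) =
      reduction F″ large reduces″ (begin
        a * c * length F″        ≡⟨ *-assoc a c _ ⟩
        a * (c * length F″)      ≤⟨ *-monoʳ-≤ a shrinks′ ⟩
        a * (d * length F′)      ≡⟨ exchange a d (length F′) ⟩
        d * (a * length F′)      ≤⟨ *-monoʳ-≤ d shrinks ⟩
        d * (b * length F)       ≡⟨ exchange d b (length F) ⟩
        b * (d * length F)       ≡⟨ *-assoc b d _ ⟨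
        b * d * length F         ∎)
      where
      open ≤-Reasoning
      exchange : ∀ a b c → a * (b * c) ≡ b * (a * c)
      exchange = solve-∀
      reduces″ : Reduces H F F″
      reduces″ X X∈ with reduces X X∈
      ... | inj₂ hit = inj₂ (Hit-mono {G} {H} {X} G⊑H hit)
      ... | inj₁ X∈′ = reduces′ X X∈′

    hit-steps : ∀ i {G D} F → Sparse G D → D + 2 * i ≤ Δ * t → Large F →
                SparseExtension G (D + 2 * i) (Reduction F (suc p ^ i) (p ^ i))
    hit-steps zero {G} {D} F S _ large =
      extension id (relax (m≤m+n D 0) S) (reduction F large (λ _ → inj₁) ≤-refl)
    hit-steps (suc i) {G} {D} F S D≤ large = hit-step F S (≤-trans (m≤m+n D _) D≤) large then λ _ S′ r →
      hit-steps i (Reduction.F′ r) S′ (≤-trans (≤-reflexive (one-more D i)) D≤) (Reduction.large r) then λ H⊑K S″ r′ →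
      extension id (relax (≤-reflexive (one-more D i)) S″) (Reduction-trans H⊑K r r′)

    -- The process starts with the at most `2 ^ N` vertex sets that have `3 * t` leaves or more. By
    -- `decay⇒0`, no set is left after `p * suc N` steps.
    hit-all : ∀ {G D} → .{{_ : NonZero p}} → Sparse G D → D + 2 * (p * suc N) ≤ Δ * t →
              SparseExtension G (D + 2 * (p * suc N)) (λ H → ∀ X → 3 * t ≤ leaves (lookup X) → Hit H X)
    hit-all S D≤ = hit-steps (p * suc N) (filter large? (subsets N)) S D≤
                     (λ X X∈ → proj₂ (∈-filter⁻ large? {xs = subsets N} X∈)) then λ _ S′ r →
                   extension id S′ (exhausted r)
      where
      large? : ∀ (X : Vec Bool N) → Dec (3 * t ≤ leaves (lookup X))
      large? X = 3 * t ≤? leaves (lookup X)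
      exhausted : ∀ {H} → Reduction (filter large? (subsets N)) (suc p ^ (p * suc N)) (p ^ (p * suc N)) H →
                  ∀ X → 3 * t ≤ leaves (lookup X) → Hit H X
      exhausted (reduction [] _ reduces _) X large =
        [ (λ ()) , id ]′ (reduces X (∈-filter⁺ large? (∈-subsets X) large))
      exhausted (reduction (_ ∷ _) _ _ shrinks) = contradiction
        (decay⇒0 p N (≤-trans (length-filter large? (subsets N)) (≤-reflexive (length-subsets N))) shrinks) (λ ())

  -- Raising the degrees of the leaves

  module _ (enough : 3 * t ≤ leaves (λ _ → true)) where

    raise-degree-by-one : ∀ {G D u} → T (good G u) → Sparse G D → D ≤ Δ * t →
                          SparseExtension G (D + 2) (λ H → deg H u ≡ suc (deg G u))
    raise-degree-by-one {G} {D} {u} gu S D≤ =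
      -- With all vertices allowed, `u` has at least `t > 0` far candidates, and any of them can
      -- serve as its new neighbour.
      raise (∑-pos (allFin N) _ (≤-trans 0<t (Candidates.many-far-candidates S D≤ (λ _ → true) enough u)))
      where
      raise : ∃[ v ] (v ∈ allFin N × 0 < ⟦ good G v ∧ true ⟧ * ⟦ ⌊ walks G g u v ≟ 0 ⌋ ⟧) →
              SparseExtension G (D + 2) (λ H → deg H u ≡ suc (deg G u))
      raise (v , _ , pos) =
        join-sparse S gu (proj₁ (T-∧⁻ {good G v} (⟦⟧-pos (proj₁ positive)))) (toWitness (⟦⟧-pos (proj₂ positive)))
        then λ _ S′ (_ , deg≡) → extension id S′ deg≡
        where
        positive : 0 < ⟦ good G v ∧ true ⟧ × 0 < ⟦ ⌊ walks G g u v ≟ 0 ⌋ ⟧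
        positive = *-pos⁻ ⟦ good G v ∧ true ⟧ pos

    raise-degree : ∀ i {G D u} → i ≤ Δ → T (leaf u) → Sparse G D → D + 2 * i ≤ Δ * t →
                   SparseExtension G (D + 2 * i) (λ H → i ≤ deg H u)
    raise-degree zero {G} {D} _ _ S _ = extension id (relax (m≤m+n D 0) S) z≤n
    raise-degree (suc i) {G} {D} {u} i<Δ lu S D≤ =
      raise-degree i (<⇒≤ i<Δ) lu S (≤-trans D+2i≤ D≤) then λ _ → raise
      where
      D+2i≤ : D + 2 * i ≤ D + 2 * suc i
      D+2i≤ = +-monoʳ-≤ D (*-monoʳ-≤ 2 (n≤1+n i))
      one-more : ∀ D i → D + 2 * i + 2 ≡ D + 2 * suc i
      one-more = solve-∀
      raise : ∀ {H} → Sparse H (D + 2 * i) → i ≤ deg H u → SparseExtension H (D + 2 * suc i) (λ K → suc i ≤ deg K u)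
      raise {H} S′ i≤ with suc i ≤? deg H u
      ... | yes i<deg = extension id (relax D+2i≤ S′) i<deg
      ... | no  i≮deg =
        -- Here the degree of `u` is below `suc i ≤ Δ`, so `u` is not saturated.
        raise-degree-by-one (T-∧⁺ {leaf u} lu (<⇒<ᵇ (≤-trans (≰⇒> i≮deg) i<Δ))) S′ (≤-trans D+2i≤ D≤)
        then λ _ S″ deg≡ → extension id (relax (≤-reflexive (one-more D i)) S″) (subst (suc i ≤_) (sym deg≡) (s≤s i≤))

    raise-degrees : ∀ i us {G D} → i ≤ Δ → Sparse G D → D + length us * (2 * i) ≤ Δ * t →
                    SparseExtension G (D + length us * (2 * i)) (λ H → ∀ u → u ∈ us → T (leaf u) → i ≤ deg H u)
    raise-degrees i [] {G} {D} i≤Δ S D≤ = extension id (relax (m≤m+n D 0) S) λ _ ()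
    raise-degrees i (u ∷ us) {G} {D} i≤Δ S D≤ =
      raise-degrees i us i≤Δ S (≤-trans D+≤ D≤) then λ _ → raise
      where
      D+≤ : D + length us * (2 * i) ≤ D + length (u ∷ us) * (2 * i)
      D+≤ = +-monoʳ-≤ D (m≤n+m _ (2 * i))
      one-more-vertex : ∀ D l i → D + l * (2 * i) + 2 * i ≡ D + (2 * i + l * (2 * i))
      one-more-vertex = solve-∀
      raise : ∀ {H} → Sparse H (D + length us * (2 * i)) → (∀ v → v ∈ us → T (leaf v) → i ≤ deg H v) →
              SparseExtension H (D + length (u ∷ us) * (2 * i)) (λ K → ∀ v → v ∈ u ∷ us → T (leaf v) → i ≤ deg K v)
      raise {H} S′ all with T? (leaf u)
      ... | no ¬lu = extension id (relax D+≤ S′)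
        λ { _ (here refl) lu → contradiction lu ¬lu ; v (there v∈) lv → all v v∈ lv }
      ... | yes lu =
        raise-degree i i≤Δ lu S′ (≤-trans (≤-reflexive (one-more-vertex D (length us) i)) D≤)
        then λ {K} H⊑K S″ i≤ → extension id (relax (≤-reflexive (one-more-vertex D (length us) i)) S″)
          λ { _ (here refl) _ → i≤ ; v (there v∈) lv → ≤-trans (all v v∈ lv) (deg-mono {N} {H} {K} H⊑K v) }

  -- Connecting the leaves

  -- A leaf farther than `g` from `r` is joined to `r` directly; any other leaf is already
  -- reachable. This may overload `r`, so the degree bound is given up and only `Augmented` is
  -- maintained.
  connect : ∀ {G r} → T (leaf r) → Augmented G → ∀ vs →
            Extension G Augmented (λ H → ∀ v → v ∈ vs → T (leaf v) → ∃[ ℓ ] Walk (graph H) r v ℓ)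
  connect lr A [] = extension id A λ _ ()
  connect {G} {r} lr A (v ∷ vs) = connect lr A vs then λ _ → link
    where
    link : ∀ {H} → Augmented H → (∀ w → w ∈ vs → T (leaf w) → ∃[ ℓ ] Walk (graph H) r w ℓ) →
           Extension H Augmented (λ K → ∀ w → w ∈ v ∷ vs → T (leaf w) → ∃[ ℓ ] Walk (graph K) r w ℓ)
    link {H} A′ all with T? (leaf v) | walks H g r v in eq
    ... | no ¬lv | _ =
      extension id A′ λ { _ (here refl) lv → contradiction lv ¬lv ; w (there w∈) → all w w∈ }
    ... | yes lv | suc _ = extension id A′
      λ { _ (here refl) _ → walks⇒Walk H g (subst (0 <_) (sym eq) (s≤s z≤n)) ; w (there w∈) → all w w∈ }
    ... | yes lv | zero = extension G⊑G+ab (join-augmented lr lv A′)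
      λ { _ (here refl) _ → 1 , step ab∈G+ab here
        ; w (there w∈) lw → map₂ (Walk-mono {N} {H} {G+ab} G⊑G+ab) (all w w∈ lw) }
      where open Join H eq

-- Disjoint stars

T-xor⁻ : ∀ {a b} → T (a xor b) → (T a × T (not b)) ⊎ (T (not a) × T b)
T-xor⁻ {true}  {false} _ = inj₁ (tt , tt)
T-xor⁻ {false} {true}  _ = inj₂ (tt , tt)

T-not⇒¬T : ∀ {b} → T (not b) → ¬ T b
T-not⇒¬T {false} _ = id

module Stars (M k : ℕ) where

  N : ℕ
  N = M * suc k

  -- A vertex encodes a pair of a star and a position in it. Position `zero` is the centre, the
  -- other `k` positions are the leaves.
  star : Fin N → Fin M
  star v = proj₁ (remQuot {M} (suc k) v)

  position : Fin N → Fin (suc k)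
  position v = proj₂ (remQuot {M} (suc k) v)

  star-combine : ∀ i j → star (combine {M} {suc k} i j) ≡ i
  star-combine i j = cong proj₁ (Fin.remQuot-combine {M} {suc k} i j)

  position-combine : ∀ i j → position (combine {M} {suc k} i j) ≡ j
  position-combine i j = cong proj₂ (Fin.remQuot-combine {M} {suc k} i j)

  combine-star : ∀ v → combine (star v) (position v) ≡ v
  combine-star v = Fin.combine-remQuot {M} (suc k) v

  isCenter : Fin N → Bool
  isCenter v = ⌊ position v Fin.≟ zero ⌋

  leaf : Fin N → Bool
  leaf v = not (isCenter v)

  center-injective : ∀ {u v} → T (isCenter u) → T (isCenter v) → star u ≡ star v → u ≡ v
  center-injective {u} {v} cu cv eq = begin
    u                              ≡⟨ combine-star u ⟨
    combine (star u) (position u)  ≡⟨ cong₂ combine eq (trans (toWitness cu) (sym (toWitness cv))) ⟩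
    combine (star v) (position v)  ≡⟨ combine-star v ⟩
    v                              ∎
    where open ≡-Reasoning

  centerOf : Fin M → Fin N
  centerOf i = combine i zero

  leafOf : Fin M → Fin k → Fin N
  leafOf i j = combine i (suc j)

  centerOf-isCenter : ∀ i → T (isCenter (centerOf i))
  centerOf-isCenter i = fromWitness (position-combine i zero)

  leafOf-leaf : ∀ i j → T (leaf (leafOf i j))
  leafOf-leaf i j = ¬T⇒T-not (λ c → contradiction (trans (sym (toWitness c)) (position-combine i (suc j))) (λ ()))

  stars : GraphOn N
  stars = record
    { edge        = λ u v → ⌊ star u Fin.≟ star v ⌋ ∧ (isCenter u xor isCenter v)
    ; edge-sym    = λ u v → cong₂ _∧_ (≟-sym (star u) (star v)) (xor-comm (isCenter u) (isCenter v))
    ; edge-irrefl = λ u → trans (cong (⌊ star u Fin.≟ star u ⌋ ∧_) (xor-same (isCenter u))) (∧-zeroʳ _)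
    }
    where
    ≟-sym : ∀ (i j : Fin M) → ⌊ i Fin.≟ j ⌋ ≡ ⌊ j Fin.≟ i ⌋
    ≟-sym i j with i Fin.≟ j | j Fin.≟ i
    ... | yes _   | yes _   = refl
    ... | no _    | no _    = refl
    ... | yes i≡j | no j≢i  = contradiction (sym i≡j) j≢i
    ... | no i≢j  | yes j≡i = contradiction (sym j≡i) i≢j

  stars⁻ : ∀ {u v} → T (edge stars u v) →
           star u ≡ star v × ((T (isCenter u) × T (leaf v)) ⊎ (T (leaf u) × T (isCenter v)))
  stars⁻ {u} {v} e with s , x ← T-∧⁻ {⌊ star u Fin.≟ star v ⌋} e = toWitness s , T-xor⁻ {isCenter u} x

  stars⁺ : ∀ {u v} → star u ≡ star v → T (isCenter u) → T (leaf v) → T (edge stars u v)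
  stars⁺ {u} {v} s cu lv = T-∧⁺ {⌊ star u Fin.≟ star v ⌋} (fromWitness s) (center-xor-leaf (isCenter u) (isCenter v) cu lv)
    where
    center-xor-leaf : ∀ a b → T a → T (not b) → T (a xor b)
    center-xor-leaf true false _ _ = tt

  leaf-neighbour-unique : ∀ {u v w} → T (leaf v) → T (edge stars u v) → T (edge stars v w) → u ≡ w
  leaf-neighbour-unique lv uv vw with stars⁻ uv | stars⁻ vw
  ... | _  , inj₂ (_ , cv) | _ = contradiction cv (T-not⇒¬T lv)
  ... | _  , inj₁ _        | _ , inj₁ (cv , _) = contradiction cv (T-not⇒¬T lv)
  ... | s  , inj₁ (cu , _) | s′ , inj₂ (_ , cw) = center-injective cu cw (trans s s′)

  -- One of the first two vertices of a cycle would be a leaf. Its two neighbours on the cycle are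
  -- distinct, whereas a leaf has a single neighbour.
  stars-acyclic : ∀ m → 3 ≤ suc m → ¬ Cycle (graph stars) m
  stars-acyclic (suc (suc m)) _ (c , c-inj , c-step , c-close) with stars⁻ (c-step zero)
  ... | _ , inj₁ (_ , leaf₁) = contradiction (c-inj (leaf-neighbour-unique leaf₁ (c-step zero) (c-step (suc zero)))) (λ ())
  ... | _ , inj₂ (leaf₀ , _) = contradiction (c-inj (leaf-neighbour-unique leaf₀ c-close (c-step zero))) (λ ())
  stars-acyclic zero       (s≤s ()) _
  stars-acyclic (suc zero) (s≤s (s≤s ())) _

  stars-deg≤ : ∀ u → deg stars u ≤ suc k
  stars-deg≤ u = ∑≤-cover (combine (star u)) (edge stars u)
    (λ v e → position v , trans (cong (λ i → combine i (position v)) (proj₁ (stars⁻ e))) (combine-star v))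

  center-deg≥ : ∀ {c} → T (isCenter c) → k ≤ deg stars c
  center-deg≥ {c} cc = injection-≤∑ (leafOf (star c)) (edge stars c)
    (λ {i} {j} eq → Fin.suc-injective (Fin.combine-injectiveʳ (star c) (suc i) (star c) (suc j) eq))
    (λ j → stars⁺ (sym (star-combine (star c) (suc j))) cc (leafOf-leaf (star c) j))

  #centers : ℕ
  #centers = ∑ᵛ (λ v → ⟦ isCenter v ⟧)

  M≤#centers : M ≤ #centers
  M≤#centers = injection-≤∑ centerOf isCenter
    (λ {i} {j} → Fin.combine-injectiveˡ i zero j zero) centerOf-isCenter

-- The augmented stars: broadcast, independence and connectivity

other : ∀ {M} → 2 ≤ M → (i : Fin M) → ∃[ j ] ¬ i ≡ j
other (s≤s (s≤s _)) zero    = suc zero , λ ()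
other (s≤s (s≤s _)) (suc i) = zero , λ ()

-- A walk of minimal length realises a distance, so strong induction on the length excludes all
-- walks.
no-Dist⇒no-Walk : ∀ G {x y} → (∀ d → ¬ Dist G x y d) → ∀ ℓ → ¬ Walk G x y ℓ
no-Dist⇒no-Walk G {x} {y} no-dist = <-rec (λ ℓ → ¬ Walk G x y ℓ) λ ℓ shorter w →
  no-dist ℓ (w , λ ℓ′ w′ → ≮⇒≥ (λ ℓ′<ℓ → shorter ℓ′<ℓ w′))

-- The summands of `budget` are a bound on the degree sum of the stars, the cost of hitting all
-- large sets of leaves, and the cost of raising the degrees of the leaves to `k`.
module Construction (M k t Δ p : ℕ) {{_ : NonZero Δ}} {{_ : NonZero p}} (0<k : 0 < k) (k<Δ : k < Δ)
                    (ball≤t : suc Δ ^ k ≤ t) (2≤M : 2 ≤ M) (3t≤M : 3 * t ≤ M)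
                    (N²≤ : M * suc k * (M * suc k) ≤ suc p * (t * t))
                    (budget : M * suc k * suc k + 2 * (p * suc (M * suc k)) + M * suc k * (2 * k) ≤ Δ * t) where

  open Stars M k
  open Augmentation stars leaf k Δ t 0<k ball≤t

  module Packing {G : GraphOn N} (A : Augmented G) where

    center-edge : ∀ {c v} → T (isCenter c) → T (edge G c v) → star c ≡ star v × T (leaf v)
    center-edge {c} cc e with new-edge A e
    ... | inj₂ (lc , _) = contradiction cc (T-not⇒¬T lc)
    ... | inj₁ old with stars⁻ old
    ...   | s , inj₁ (_ , lv) = s , lv
    ...   | _ , inj₂ (lc , _) = contradiction cc (T-not⇒¬T lc)

    -- All neighbours of a centre are leaves of its own star. Thus one step from a centre ends at a
    -- leaf, and two steps between centres stay in one star, which has a single centre.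
    centers-far : ∀ {x y ℓ} → T (isCenter x) → T (isCenter y) → ¬ x ≡ y → Walk (graph G) x y ℓ → 3 ≤ ℓ
    centers-far cx cy x≢y here = contradiction refl x≢y
    centers-far cx cy x≢y (step e here) = contradiction cy (T-not⇒¬T (proj₂ (center-edge cx e)))
    centers-far cx cy x≢y (step e (step e′ here)) =
      contradiction (center-injective cx cy (trans (proj₁ (center-edge cx e)) (sym (proj₁ (center-edge cy (Adj-sym (graph G) e′)))))) x≢y
    centers-far cx cy x≢y (step _ (step _ (step _ _))) = s≤s (s≤s (s≤s z≤n))

    broadcast : Fin N → ℕ
    broadcast v = 2 * ⟦ isCenter v ⟧

    broadcast≤2 : ∀ v → broadcast v ≤ 2
    broadcast≤2 v with isCenter v
    ... | true  = ≤-refl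
    ... | false = z≤n

    broadcast-center : ∀ {v} → 0 < broadcast v → T (isCenter v)
    broadcast-center pos = ⟦⟧-pos (proj₂ (*-pos⁻ 2 pos))

    -- The value 2 respects the eccentricity because there is a second star, whose centre is at
    -- distance at least 3.
    broadcast-independent : Connected (graph G) → IndependentBroadcast (graph G) broadcast
    broadcast-independent (_ , walk) = below-ecc , λ x y x≢y 0<fx 0<fy d (w , _) →
        ≤-trans (s≤s (⊔-lub (broadcast≤2 x) (broadcast≤2 y)))
                (centers-far (broadcast-center 0<fx) (broadcast-center 0<fy) x≢y w)
      where
      below-ecc : ∀ x e → Ecc (graph G) x e → broadcast x ≤ e
      below-ecc x e (_ , ecc) with broadcast x ≤? e
      ... | yes fx≤e = fx≤e
      ... | no  fx≰e = contradiction (proj₂ (walk x y)) (no-Dist⇒no-Walk (graph G) no-dist _)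
        where
        e<fx : e < broadcast x
        e<fx = ≰⇒> fx≰e
        j : Fin M
        j = proj₁ (other 2≤M (star x))
        y : Fin N
        y = centerOf j
        x≢y : ¬ x ≡ y
        x≢y x≡y = proj₂ (other 2≤M (star x)) (trans (cong star x≡y) (star-combine j zero))
        -- A distance `d` would satisfy `3 ≤ d ≤ e < 2`; its absence contradicts connectedness.
        no-dist : ∀ d → ¬ Dist (graph G) x y d
        no-dist d D@(w , _) = contradiction (≤-trans 3≤d (≤-trans (ecc y d D) (<⇒≤ e<fx))) (<⇒≱ (s≤s (broadcast≤2 x)))
          where
          3≤d : 3 ≤ d
          3≤d = centers-far (broadcast-center (≤-trans (s≤s z≤n) e<fx)) (centerOf-isCenter j) x≢y w

    broadcast-weight : weight (graph G) broadcast ≡ 2 * #centers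
    broadcast-weight = ∑-*ˡ (allFin N) 2 _

  -- An independent set has fewer than `3 * t` leaves, since otherwise it would contain both ends of
  -- an edge; its other vertices are centres.
  independent-bound : ∀ {G} → (∀ X → 3 * t ≤ leaves (lookup X) → Hit G X) →
                      ∀ S → Independent (graph G) S → length S ≤ #centers + 3 * t
  independent-bound {G} hit S (unique , independent) = begin
    length S                                              ≤⟨ unique-length≤∑ inS S unique (λ x x∈ → fromWitness x∈) ⟩
    ∑ᵛ (λ v → ⟦ inS v ⟧)                                  ≤⟨ ∑-mono (allFin N) split ⟩
    ∑ᵛ (λ v → ⟦ isCenter v ⟧ + ⟦ leaf v ∧ lookup X v ⟧)   ≡⟨ ∑-+ (allFin N) _ _ ⟩
    #centers + leaves (lookup X)                          ≤⟨ +-monoʳ-≤ #centers (<⇒≤ (≰⇒> not-large)) ⟩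
    #centers + 3 * t                                      ∎
    where
    open ≤-Reasoning
    open Membership (Fin._≟_ {N}) using (_∈?_)
    inS : Fin N → Bool
    inS v = ⌊ v ∈? S ⌋
    X : Vec Bool N
    X = Vec.tabulate inS
    split : ∀ v → ⟦ inS v ⟧ ≤ ⟦ isCenter v ⟧ + ⟦ leaf v ∧ lookup X v ⟧
    split v rewrite lookup∘tabulate inS v with isCenter v | inS v
    ... | _     | false = z≤n
    ... | true  | true  = s≤s z≤n
    ... | false | true  = s≤s z≤n
    not-large : ¬ 3 * t ≤ leaves (lookup X)
    not-large large with u , v , Xu , Xv , uv ← hit X large = independent u v (member Xu) (member Xv) uv
      where
      member : ∀ {v} → T (lookup X v) → v ∈ S
      member {v} Xv = toWitness (subst T (lookup∘tabulate inS v) Xv)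

  record Result (G : GraphOn N) : Set where
    field
      is-augmented : Augmented G
      connected    : Connected (graph G)
      min-degree   : MinDegreeAtLeast (graph G) k
      hits         : ∀ X → 3 * t ≤ leaves (lookup X) → Hit G X

  private
    i₀ : Fin M
    i₀ = Fin.fromℕ< (≤-trans (s≤s z≤n) 2≤M)
    j₀ : Fin k
    j₀ = Fin.fromℕ< 0<k
    root : Fin N
    root = leafOf i₀ j₀

  stars-sparse : Sparse stars (N * suc k)
  stars-sparse = record
    { augmented = record { base⊑ = id ; new-edge = inj₁ ; girth = λ m 3≤ c → contradiction c (stars-acyclic m 3≤) }
    ; deg≤  = λ u → ≤-trans (stars-deg≤ u) k<Δ
    ; ∑deg≤ = ≤-trans (∑-mono (allFin N) stars-deg≤) (≤-reflexive (∑ᵛ-const N (suc k)))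
    }

  enough : 3 * t ≤ leaves (λ _ → true)
  -- One leaf from each of the `M` stars suffices.
  enough = ≤-trans 3t≤M (injection-≤∑ (λ i → leafOf i j₀) (λ v → leaf v ∧ true)
    (λ {i} {j} → Fin.combine-injectiveˡ i (suc j₀) j (suc j₀)) (λ i → T-∧⁺ (leafOf-leaf i j₀) tt))

  connected-from-root : ∀ {G} → Augmented G →
    (∀ v → v ∈ allFin N → T (leaf v) → ∃[ ℓ ] Walk (graph G) root v ℓ) → Connected (graph G)
  connected-from-root {G} A from-root = ≤-trans (s≤s z≤n) (Fin.toℕ<n root) , λ x y →
    _ , Walk-++ (Walk-sym (proj₂ (reach x))) (proj₂ (reach y))
    where
    reach : ∀ x → ∃[ ℓ ] Walk (graph G) root x ℓ
    reach x with T? (isCenter x)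
    ... | no ¬cx = from-root x (∈-allFin x) (¬T⇒T-not ¬cx)
    -- A centre is reached through a leaf of its own star.
    ... | yes cx = _ , Walk-++ (proj₂ (from-root ℓ (∈-allFin ℓ) ℓ-leaf)) (step (Adj-sym (graph G) xℓ) here)
      where
      ℓ = leafOf (star x) j₀
      ℓ-leaf = leafOf-leaf (star x) j₀
      xℓ : T (edge G x ℓ)
      xℓ = base⊑ A (stars⁺ (sym (star-combine (star x) (suc j₀))) cx ℓ-leaf)

  min-degree≥ : ∀ {G} → Augmented G → (∀ u → T (leaf u) → k ≤ deg G u) → MinDegreeAtLeast (graph G) k
  min-degree≥ {G} A leaf-deg u rewrite degree≡deg G u with T? (isCenter u)
  ... | yes cu = ≤-trans (center-deg≥ cu) (deg-mono {N} {stars} {G} (base⊑ A) u)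
  ... | no ¬cu = leaf-deg u (¬T⇒T-not ¬cu)

  result : ∃[ G ] Result G
  result = assemble (hit-all N²≤ stars-sparse (m+n≤o⇒m≤o _ budget))
    where
    budget′ : N * suc k + 2 * (p * suc N) + length (allFin N) * (2 * k) ≤ Δ * t
    budget′ = subst (λ n → N * suc k + 2 * (p * suc N) + n * (2 * k) ≤ Δ * t) (sym (length-tabulate {n = N} id)) budget
    assemble : SparseExtension stars (N * suc k + 2 * (p * suc N)) (λ H → ∀ X → 3 * t ≤ leaves (lookup X) → Hit H X) →
               ∃[ G ] Result G
    assemble (extension {G₁} _ S₁ hits) with raise-degrees enough k (allFin N) (<⇒≤ k<Δ) S₁ budget′
    ... | extension {G₂} G₁⊑G₂ S₂ degrees with connect {G₂} {root} (leafOf-leaf i₀ j₀) (augmented S₂) (allFin N)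
    ...   | extension {G₃} G₂⊑G₃ A₃ reach = G₃ , record
      { is-augmented = A₃
      ; connected    = connected-from-root A₃ reach
      ; min-degree   = min-degree≥ A₃ (λ u lu → ≤-trans (degrees u (∈-allFin u) lu) (deg-mono {N} {G₂} {G₃} G₂⊑G₃ u))
      ; hits         = λ X large → Hit-mono {G₁} {G₃} {X} (λ {u} {v} → G₂⊑G₃ {u} {v} ∘ G₁⊑G₂) (hits X large)
      }

  -- Let `c` be the number of centres. Since `(k - 1) * 3t ≤ M ≤ c`, the bound `a ≤ c + 3t` yields
  -- `(k - 1) * a ≤ k * c`, while the broadcast on the centres yields `2 * c ≤ b`.
  ratio : ∀ {G} → Result G → (k ∸ 1) * (3 * t) ≤ M → ∀ a b →
          IsIndependenceNumber (graph G) a → IsBroadcastIndependenceNumber (graph G) b → 2 * (k ∸ 1) * a ≤ k * b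
  ratio {G} R small a b ((S , S-independent , refl) , _) (_ , b-max) = begin
    2 * (k ∸ 1) * length S                             ≤⟨ *-monoʳ-≤ (2 * (k ∸ 1)) (independent-bound {G} (Result.hits R) S S-independent) ⟩
    2 * (k ∸ 1) * (#centers + 3 * t)                   ≡⟨ expand (k ∸ 1) #centers (3 * t) ⟩
    2 * ((k ∸ 1) * #centers + (k ∸ 1) * (3 * t))       ≤⟨ *-monoʳ-≤ 2 (+-monoʳ-≤ ((k ∸ 1) * #centers) (≤-trans small M≤#centers)) ⟩
    2 * ((k ∸ 1) * #centers + #centers)                ≡⟨ collect (k ∸ 1) #centers ⟩
    suc (k ∸ 1) * (2 * #centers)                       ≡⟨ cong₂ _*_ (m+[n∸m]≡n 0<k) (sym (broadcast-weight)) ⟩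
    k * weight (graph G) broadcast                     ≤⟨ *-monoʳ-≤ k (b-max broadcast (broadcast-independent (Result.connected R))) ⟩
    k * b                                              ∎
    where
    open ≤-Reasoning
    open Packing (Result.is-augmented R)
    expand : ∀ l c s → 2 * l * (c + s) ≡ 2 * (l * c + l * s)
    expand = solve-∀
    collect : ∀ l c → 2 * (l * c + c) ≡ suc l * (2 * c)
    collect = solve-∀

-- Choice of the parameters

theorem2 : (k : ℕ) → 0 < k →
    Σ Graph λ G → Connected G × GirthAtLeast G k × MinDegreeAtLeast G k
    × (∀ a b → IsIndependenceNumber G a → IsBroadcastIndependenceNumber G b →
    2 * (k ∸ 1) * a ≤ k * b)
theorem2 k@(suc l) 0<k = graph G , connected R , girth (is-augmented R) , min-degree R , ratio R small
  where
  -- C = N / t, a set family shrinks by the factor p / (p + 1) with every new edge, and K N bounds the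
  -- degree sum throughout, so that at most K N / Δ = t vertices are ever saturated.
  C p K Δ t M N : ℕ
  C = 3 * k * suc k
  p = C * C ∸ 1
  K = suc k + 4 * p + 2 * k
  Δ = K * C
  -- As `C`, `p`, `K` and `Δ` depend on `k` alone, `t` can be set to the bound on the balls without
  -- circularity.
  t = suc Δ ^ k
  -- This makes `3 * t` exactly the fraction `1/k` of the number of stars.
  M = k * (3 * t)
  N = M * suc k

  open ≤-Reasoning

  0<t : 0 < t
  0<t = m^n>0 (suc Δ) k

  3≤C : 3 ≤ C
  3≤C = *-mono-≤ (*-monoʳ-≤ 3 0<k) (s≤s (z≤n {k}))

  suc-p : suc p ≡ C * C
  suc-p = m+[n∸m]≡n (*-mono-≤ (≤-trans (s≤s z≤n) 3≤C) (≤-trans (s≤s z≤n) 3≤C))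

  instance
    p≢0 : NonZero p
    p≢0 = >-nonZero (≤-pred (subst (2 ≤_) (sym suc-p) (≤-trans (s≤s (s≤s z≤n)) (*-mono-≤ 3≤C 3≤C))))
    Δ≢0 : NonZero Δ
    Δ≢0 = >-nonZero (*-mono-≤ {1} {K} {1} {C} (s≤s z≤n) (≤-trans (s≤s z≤n) 3≤C))

  k<Δ : k < Δ
  k<Δ = begin
    suc k        ≤⟨ m≤m+n (suc k) (4 * p) ⟩
    suc k + 4 * p ≤⟨ m≤m+n (suc k + 4 * p) (2 * k) ⟩
    K            ≤⟨ m≤m*n K C {{>-nonZero (≤-trans (s≤s z≤n) 3≤C)}} ⟩
    Δ            ∎

  3t≤M : 3 * t ≤ M
  3t≤M = m≤m+n (3 * t) (l * (3 * t))

  2≤M : 2 ≤ M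
  2≤M = ≤-trans (s≤s (s≤s z≤n)) (≤-trans (*-monoʳ-≤ 3 0<t) 3t≤M)

  N≡C*t : N ≡ C * t
  N≡C*t = regroup k t
    where
    regroup : ∀ k t → k * (3 * t) * suc k ≡ 3 * k * suc k * t
    regroup = solve-∀

  N²≤ : N * N ≤ suc p * (t * t)
  N²≤ = ≤-reflexive (begin-equality
    N * N              ≡⟨ cong₂ _*_ N≡C*t N≡C*t ⟩
    C * t * (C * t)    ≡⟨ interchange C t ⟩
    C * C * (t * t)    ≡⟨ cong (_* (t * t)) suc-p ⟨
    suc p * (t * t)    ∎)
    where
    interchange : ∀ c t → c * t * (c * t) ≡ c * c * (t * t)
    interchange = solve-∀

  budget : N * suc k + 2 * (p * suc N) + N * (2 * k) ≤ Δ * t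
  budget = begin
    -- The estimate `suc N ≤ N + N` absorbs the extra `p` rounds and accounts for the coefficient 4
    -- of `p` in `K`.
    N * suc k + 2 * (p * suc N) + N * (2 * k)     ≤⟨ +-monoˡ-≤ (N * (2 * k)) (+-monoʳ-≤ (N * suc k) (*-monoʳ-≤ 2 (*-monoʳ-≤ p (+-monoˡ-≤ N 0<N)))) ⟩
    N * suc k + 2 * (p * (N + N)) + N * (2 * k)   ≡⟨ collect N k p ⟩
    K * N                                         ≡⟨ cong (K *_) N≡C*t ⟩
    K * (C * t)                                   ≡⟨ *-assoc K C t ⟨
    Δ * t                                         ∎
    where
    0<N : 0 < N
    0<N = *-mono-≤ (≤-trans (s≤s z≤n) 2≤M) (s≤s (z≤n {k}))
    collect : ∀ n k p → n * suc k + 2 * (p * (n + n)) + n * (2 * k) ≡ (suc k + 4 * p + 2 * k) * n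
    collect = solve-∀

  small : l * (3 * t) ≤ M
  small = m≤n+m (l * (3 * t)) (3 * t)

  open Construction M k t Δ p 0<k k<Δ ≤-refl 2≤M 3t≤M N²≤ budget
  open Augmentation (Stars.stars M k) (Stars.leaf M k) k Δ t 0<k ≤-refl using (girth)
  open Result

  G = proj₁ result
  R = proj₂ result
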